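{- The category $\mathbf{KS}$ of Kegelspitzen and affine Scott-continuous maps, as a category equivalent to the category $[\mathbb{L}_{\leq 1},\mathbf{Dcpo}_{\perp!}]_\times$, is algebraically compact for locally continuous endofunctors.
   Context: A convex set is a set $X$ with, for each vector $\vec r=(r_1,\dots,r_m)$ of non-negative reals with $\sum_i r_i=1$, an operation $X^m\to X$, $(x_i)_i\mapsto\sum_i r_i\cdot x_i$, such that $\sum_j \delta_{ij}\cdot x_j=x_i$ (with $\delta_{ij}$ the Kronecker delta) and $\sum_i r_i\cdot(\sum_j s_{i,j}\cdot x_j)=\sum_j(\sum_i r_i s_{i,j})\cdot x_j$ for every $m\times n$ matrix $(s_{i,j})$ of non-negative reals with $\sum_j s_{i,j}=1$ for each $i$. Affine maps are functions preserving these operations. Write $x\oplus_\lambda y=\lambda\cdot x+(1-\lambda)\cdot y$ for $\lambda\in[0,1]$. A convex dcpo is a convex set with a dcpo structure such that all the operations $X^m\to X$ are Scott-continuous. A pointed convex dcpo is a convex dcpo with a least element $\perp$, which serves as zero element of the convex structure: for non-negative $r_i$ with $\sum_i r_i\le 1$ one sets $\sum_i r_i\cdot x_i:=\sum_i r_i\cdot x_i+(1-\sum_i r_i)\cdot\perp$. A Kegelspitze is a pointed convex dcpo $X$ such that the scalar multiplication $[0,1]\times X\to X$, $\lambda\cdot x=x\oplus_\lambda\perp$, is Scott-continuous in both arguments. $\mathbf{KS}$ is the category of Kegelspitzen and affine strict Scott-continuous maps (called "affine Scott-continuous maps"), with hom-sets ordered pointwise; strict means preserving $\perp$. $\mathbf{Dcpo}_{\perp!}$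 is the category of pointed dcpos and strict Scott-continuous maps. $\mathbb{L}_{\leq 1}$ is the category with natural numbers as objects and $\mathbb{L}_{\leq1}(n,m)=\mathcal D^\infty_{\leq1}(n)^m$, where $\mathcal D^\infty_{\leq1}(n)=\{(q_k)\in[0,1]^n\mid\sum_kq_k\le1\}$, ordered pointwise; composition of $f:n\to m$ and $g:m\to p$ is $(g\circ f)(k)(i)=\sum_jg(k)(j)f(j)(i)$ and identities are the families of Dirac vectors. $[\mathbb{L}_{\leq 1},\mathbf{Dcpo}_{\perp!}]_\times$ is the category of finite product-preserving functors that are strict and Scott-continuous on hom-sets, with natural transformations between them. An endofunctor $F$ on a $\mathbf{Dcpo}_{\perp!}$-enriched category $\mathbf C$ is locally continuous if every $F_{X,Y}:\mathbf C(X,Y)\to\mathbf C(FX,FY)$ is Scott-continuous. A category $\mathbf C$ is algebraically compact for a class $\mathcal L$ of endofunctors on $\mathbf C$ if every endofunctor $F$ in $\mathcal L$ has a canonical fixpoint $\mu F$, which is the initial $F$-algebra and at the same time the inverse of the final $F$-coalgebra. -}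

module Defs where

open import Level using (Level; 0ℓ; _⊔_) renaming (suc to lsuc)
open import Algebra.Bundles using (CommutativeRing)
import Algebra.Properties.Semiring.Sum as SemiringSum
open import Data.Fin.Base using (Fin; zero; suc)
open import Data.Nat.Base as ℕ using (ℕ; zero; suc)
import Data.Nat.Properties as ℕ
open import Data.Product using (∃; ∃!; _×_; _,_; proj₁; proj₂)
open import Data.Rational as ℚ using (ℚ; 0ℚ; 1ℚ; ½)
import Data.Rational.Properties as ℚ
open import Data.Rational.Solver using (module +-*-Solver)
open import Data.Sum using (inj₁; inj₂)
open import Data.Vec.Functional using (Vector; []; _∷_)
open import Relation.Binary.Bundles using (Setoid; Poset)
import Relation.Binary.Construct.On as On
open import Relation.Binary.Core using (_Preserves_⟶_)
open import Relation.Binary.Definitions using (Minimum)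
open import Relation.Binary.Structures using (IsEquivalence; IsPartialOrder)
open import Relation.Binary.PropositionalEquality as ≡ using (_≡_)
import Relation.Binary.Reasoning.Setoid as ≈-Reasoning

-- A real is a Cauchy sequence of rationals; equality of reals means that the difference is a null
-- sequence, and x ≤ y that for each ε > 0 eventually xₙ < yₙ + ε.

module Reals where

  Eventually : (ℕ → Set) → Set
  Eventually P = ∃ λ N → ∀ n → N ℕ.≤ n → P n

  IsCauchy : (ℕ → ℚ) → Set
  IsCauchy s = ∀ ε → 0ℚ ℚ.< ε →
               ∃ λ N → ∀ m n → N ℕ.≤ m → N ℕ.≤ n → ℚ.∣ s m ℚ.- s n ∣ ℚ.< ε

  record ℝ : Set where
    no-eta-equality  -- so that the operations below are neutral for the conversion checker
    constructor real
    field
      seq    : ℕ → ℚ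
      cauchy : IsCauchy seq

  open ℝ public

  infix 4 _≈_ _≤_

  record _≈_ (x y : ℝ) : Set where
    constructor mk≈
    field
      null : ∀ ε → 0ℚ ℚ.< ε → Eventually λ n → ℚ.∣ seq x n ℚ.- seq y n ∣ ℚ.< ε

  record _≤_ (x y : ℝ) : Set where
    constructor mk≤
    field
      below : ∀ ε → 0ℚ ℚ.< ε → Eventually λ n → seq x n ℚ.< seq y n ℚ.+ ε

  open _≈_ public
  open _≤_ public

  open +-*-Solver using (solve; _:=_; con) renaming (_:+_ to _⊕_; _:*_ to _⊗_; _:-_ to _⊖_; :-_ to ⊖′_)

  ev-map₂ : {P Q R : ℕ → Set} → (∀ n → P n → Q n → R n) →
            Eventually P → Eventually Q → Eventually R
  ev-map₂ f (M , p) (N , q) = M ℕ.⊔ N , λ n h →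
    f n (p n (ℕ.m⊔n≤o⇒m≤o M N h)) (q n (ℕ.m⊔n≤o⇒n≤o M N h))

  ev-map : {P R : ℕ → Set} → (∀ n → P n → R n) → Eventually P → Eventually R
  ev-map f (M , p) = M , λ n h → f n (p n h)

  half>0 : ∀ {ε} → 0ℚ ℚ.< ε → 0ℚ ℚ.< ½ ℚ.* ε
  half>0 {ε} h = ≡.subst (ℚ._< ½ ℚ.* ε) (ℚ.*-zeroʳ ½) (ℚ.*-monoʳ-<-pos ½ h)

  half+half : ∀ ε → ½ ℚ.* ε ℚ.+ ½ ℚ.* ε ≡ ε
  half+half = solve 1 (λ e → con ½ ⊗ e ⊕ con ½ ⊗ e := e) ≡.refl

  ∣∣-flip : ∀ p q → ℚ.∣ p ℚ.- q ∣ ≡ ℚ.∣ q ℚ.- p ∣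
  ∣∣-flip p q = ≡.trans (≡.cong ℚ.∣_∣ (solve 2 (λ p q → p ⊖ q := ⊖′ (q ⊖ p)) ≡.refl p q)) (ℚ.∣-p∣≡∣p∣ (q ℚ.- p))

  p≤∣p∣ : ∀ p → p ℚ.≤ ℚ.∣ p ∣
  p≤∣p∣ p with ℚ.≤-total 0ℚ p
  ... | inj₁ h = ℚ.≤-reflexive (≡.sym (ℚ.0≤p⇒∣p∣≡p h))
  ... | inj₂ h = ℚ.≤-trans h (ℚ.0≤∣p∣ p)

  ∣∣<⇒< : ∀ {p q ε} → ℚ.∣ p ℚ.- q ∣ ℚ.< ε → p ℚ.< q ℚ.+ ε
  ∣∣<⇒< {p} {q} {ε} h = ≡.subst (ℚ._< q ℚ.+ ε) (solve 2 (λ p q → q ⊕ (p ⊖ q) := p) ≡.refl p q)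
    (ℚ.+-monoʳ-< q (ℚ.≤-<-trans (p≤∣p∣ _) h))

  <⇒∣∣< : ∀ {p q ε} → p ℚ.< q ℚ.+ ε → q ℚ.< p ℚ.+ ε → ℚ.∣ p ℚ.- q ∣ ℚ.< ε
  <⇒∣∣< {p} {q} {ε} h k with ℚ.∣p∣≡p∨∣p∣≡-p (p ℚ.- q)
  ... | inj₁ e = ≡.subst₂ ℚ._<_ (≡.sym e) (solve 2 (λ q e → (q ⊕ e) ⊖ q := e) ≡.refl q ε) (ℚ.+-monoˡ-< (ℚ.- q) h)
  ... | inj₂ e = ≡.subst₂ ℚ._<_ (≡.trans (solve 2 (λ p q → q ⊖ p := ⊖′ (p ⊖ q)) ≡.refl p q) (≡.sym e))
                   (solve 2 (λ q e → (q ⊕ e) ⊖ q := e) ≡.refl p ε) (ℚ.+-monoˡ-< (ℚ.- p) k)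

  add-bound : ∀ a b c d ε → ℚ.∣ a ℚ.- c ∣ ℚ.< ½ ℚ.* ε → ℚ.∣ b ℚ.- d ∣ ℚ.< ½ ℚ.* ε →
              ℚ.∣ (a ℚ.+ b) ℚ.- (c ℚ.+ d) ∣ ℚ.< ε
  add-bound a b c d ε h k = ≡.subst₂ ℚ._<_
    (≡.cong ℚ.∣_∣ (solve 4 (λ a b c d → (a ⊖ c) ⊕ (b ⊖ d) := (a ⊕ b) ⊖ (c ⊕ d)) ≡.refl a b c d))
    (half+half ε)
    (ℚ.≤-<-trans (ℚ.∣p+q∣≤∣p∣+∣q∣ (a ℚ.- c) (b ℚ.- d)) (ℚ.+-mono-< h k))

  neg-bound : ∀ a c {ε} → ℚ.∣ a ℚ.- c ∣ ℚ.< ε → ℚ.∣ (ℚ.- a) ℚ.- (ℚ.- c) ∣ ℚ.< ε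
  neg-bound a c {ε} = ≡.subst (ℚ._< ε)
    (≡.trans (∣∣-flip a c) (≡.cong ℚ.∣_∣ (solve 2 (λ a c → c ⊖ a := (⊖′ a) ⊖ (⊖′ c)) ≡.refl a c)))

  *>0 : ∀ {p q} → 0ℚ ℚ.< p → 0ℚ ℚ.< q → 0ℚ ℚ.< p ℚ.* q
  *>0 {p} {q} h k = ℚ.positive⁻¹ _ {{ℚ.pos*pos⇒pos p {{ℚ.positive h}} q {{ℚ.positive k}}}}

  quotient : ∀ {A ε} → 0ℚ ℚ.< A → 0ℚ ℚ.< ε → ∃ λ δ → (0ℚ ℚ.< δ) × (A ℚ.* δ ≡ ε)
  quotient {A} {ε} h k = ε ℚ.* i
    , *>0 k (ℚ.positive⁻¹ i {{ℚ.1/pos⇒pos A {{ℚ.positive h}}}})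
    , ≡.trans (solve 3 (λ a e i → a ⊗ (e ⊗ i) := e ⊗ (a ⊗ i)) ≡.refl A ε i)
        (≡.trans (≡.cong (ε ℚ.*_) (ℚ.*-inverseʳ A {{nz}})) (ℚ.*-identityʳ ε))
    where nz = ℚ.pos⇒nonZero A {{ℚ.positive h}}
          i = (ℚ.1/ A) {{nz}}

  +>0 : ∀ {p q} → 0ℚ ℚ.< p → 0ℚ ℚ.< q → 0ℚ ℚ.< p ℚ.+ q
  +>0 {p} {q} h k = ≡.subst (ℚ._< p ℚ.+ q) (ℚ.+-identityˡ 0ℚ) (ℚ.+-mono-< h k)

  0<1 : 0ℚ ℚ.< 1ℚ
  0<1 = ℚ.positive⁻¹ 1ℚ

  1⊓>0 : ∀ {q} → 0ℚ ℚ.< q → 0ℚ ℚ.< 1ℚ ℚ.⊓ q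
  1⊓>0 {q} h with ℚ.⊓-sel 1ℚ q
  ... | inj₁ e = ≡.subst (0ℚ ℚ.<_) (≡.sym e) 0<1
  ... | inj₂ e = ≡.subst (0ℚ ℚ.<_) (≡.sym e) h

  *-mono-<′ : ∀ {p q r s} → 0ℚ ℚ.≤ p → 0ℚ ℚ.< s → p ℚ.< q → r ℚ.< s → p ℚ.* r ℚ.< q ℚ.* s
  *-mono-<′ {p} {q} {r} {s} p≥0 s>0 h k = ℚ.≤-<-trans
    (ℚ.*-monoˡ-≤-nonNeg p {{ℚ.nonNegative p≥0}} (ℚ.<⇒≤ k))
    (ℚ.*-monoˡ-<-pos s {{ℚ.positive s>0}} h)

  mul-bound : ∀ a b c d {A B δ} → ℚ.∣ a ∣ ℚ.< A → ℚ.∣ d ∣ ℚ.< B → 0ℚ ℚ.< δ →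
              ℚ.∣ a ℚ.- c ∣ ℚ.< δ → ℚ.∣ b ℚ.- d ∣ ℚ.< δ →
              ℚ.∣ a ℚ.* b ℚ.- c ℚ.* d ∣ ℚ.< (A ℚ.+ B) ℚ.* δ
  mul-bound a b c d {A} {B} {δ} ha hd δ>0 h k = ≡.subst₂ ℚ._<_
    (≡.cong ℚ.∣_∣ (solve 4 (λ a b c d → a ⊗ (b ⊖ d) ⊕ d ⊗ (a ⊖ c) := a ⊗ b ⊖ c ⊗ d) ≡.refl a b c d))
    (≡.sym (ℚ.*-distribʳ-+ δ A B))
    (ℚ.≤-<-trans (ℚ.∣p+q∣≤∣p∣+∣q∣ (a ℚ.* (b ℚ.- d)) (d ℚ.* (a ℚ.- c)))
      (≡.subst₂ (λ u v → u ℚ.+ v ℚ.< A ℚ.* δ ℚ.+ B ℚ.* δ)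
        (≡.sym (ℚ.∣p*q∣≡∣p∣*∣q∣ a (b ℚ.- d))) (≡.sym (ℚ.∣p*q∣≡∣p∣*∣q∣ d (a ℚ.- c)))
        (ℚ.+-mono-< (*-mono-<′ (ℚ.0≤∣p∣ a) δ>0 ha k) (*-mono-<′ (ℚ.0≤∣p∣ d) δ>0 hd h))))

  bounded : ∀ s → IsCauchy s → ∃ λ B → (0ℚ ℚ.< B) × Eventually λ n → ℚ.∣ s n ∣ ℚ.< B
  bounded s c with c 1ℚ 0<1
  ... | N , h = 1ℚ ℚ.+ ℚ.∣ s N ∣
              , ℚ.<-≤-trans 0<1 (≡.subst (ℚ._≤ 1ℚ ℚ.+ ℚ.∣ s N ∣) (ℚ.+-identityʳ 1ℚ) (ℚ.+-monoʳ-≤ 1ℚ (ℚ.0≤∣p∣ (s N))))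
              , N , λ n N≤n → ≡.subst (λ t → ℚ.∣ t ∣ ℚ.< 1ℚ ℚ.+ ℚ.∣ s N ∣)
                  (solve 2 (λ p q → (p ⊖ q) ⊕ q := p) ≡.refl (s n) (s N))
                  (ℚ.≤-<-trans (ℚ.∣p+q∣≤∣p∣+∣q∣ (s n ℚ.- s N) (s N))
                    (ℚ.+-monoˡ-< ℚ.∣ s N ∣ (h n N N≤n ℕ.≤-refl)))

  *-isCauchy : ∀ s t → IsCauchy s → IsCauchy t → IsCauchy (λ n → s n ℚ.* t n)
  *-isCauchy s t cs ct ε ε>0 =
    let A , A>0 , K , p = bounded s cs
        B , B>0 , L , q = bounded t ct
        δ , δ>0 , e = quotient (+>0 A>0 B>0) ε>0
        M , u = cs δ δ>0
        N , v = ct δ δ>0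
    in (K ℕ.⊔ L) ℕ.⊔ (M ℕ.⊔ N) , λ m n hm hn →
    let m₁ = ℕ.m⊔n≤o⇒m≤o (K ℕ.⊔ L) (M ℕ.⊔ N) hm
        m₂ = ℕ.m⊔n≤o⇒n≤o (K ℕ.⊔ L) (M ℕ.⊔ N) hm
        n₁ = ℕ.m⊔n≤o⇒m≤o (K ℕ.⊔ L) (M ℕ.⊔ N) hn
        n₂ = ℕ.m⊔n≤o⇒n≤o (K ℕ.⊔ L) (M ℕ.⊔ N) hn
    in ≡.subst (ℚ.∣ s m ℚ.* t m ℚ.- s n ℚ.* t n ∣ ℚ.<_) e
         (mul-bound (s m) (t m) (s n) (t n) (p m (ℕ.m⊔n≤o⇒m≤o K L m₁)) (q n (ℕ.m⊔n≤o⇒n≤o K L n₁)) δ>0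
           (u m n (ℕ.m⊔n≤o⇒m≤o M N m₂) (ℕ.m⊔n≤o⇒m≤o M N n₂))
           (v m n (ℕ.m⊔n≤o⇒n≤o M N m₂) (ℕ.m⊔n≤o⇒n≤o M N n₂)))

  infixl 6 _+_ _-_
  infixl 7 _*_
  infix  8 -_

  fromℚ : ℚ → ℝ
  fromℚ q .seq n = q
  fromℚ q .cauchy ε ε>0 = 0 , λ m n _ _ → ≡.subst (ℚ._< ε) (≡.cong ℚ.∣_∣ (≡.sym (ℚ.+-inverseʳ q))) ε>0

  0ᵣ 1ᵣ : ℝ
  0ᵣ = fromℚ 0ℚ
  1ᵣ = fromℚ 1ℚ

  _+_ : ℝ → ℝ → ℝ
  (x + y) .seq n = seq x n ℚ.+ seq y n
  (x + y) .cauchy ε ε>0 with cauchy x (½ ℚ.* ε) (half>0 ε>0) | cauchy y (½ ℚ.* ε) (half>0 ε>0)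
  ... | M , p | N , q = M ℕ.⊔ N , λ m n hm hn → add-bound (seq x m) (seq y m) (seq x n) (seq y n) ε
    (p m n (ℕ.m⊔n≤o⇒m≤o M N hm) (ℕ.m⊔n≤o⇒m≤o M N hn))
    (q m n (ℕ.m⊔n≤o⇒n≤o M N hm) (ℕ.m⊔n≤o⇒n≤o M N hn))

  -_ : ℝ → ℝ
  (- x) .seq n = ℚ.- seq x n
  (- x) .cauchy ε ε>0 with cauchy x ε ε>0
  ... | N , p = N , λ m n hm hn → neg-bound (seq x m) (seq x n) (p m n hm hn)

  _-_ : ℝ → ℝ → ℝ
  x - y = x + (- y)

  _*_ : ℝ → ℝ → ℝ
  (x * y) .seq n = seq x n ℚ.* seq y n
  (x * y) .cauchy = *-isCauchy (seq x) (seq y) (cauchy x) (cauchy y)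

  pointwise-≈ : ∀ {x y} → (∀ n → seq x n ≡ seq y n) → x ≈ y
  pointwise-≈ {x} {y} h .null ε ε>0 = 0 , λ n _ → ≡.subst (λ q → ℚ.∣ seq x n ℚ.- q ∣ ℚ.< ε) (h n)
    (≡.subst (ℚ._< ε) (≡.cong ℚ.∣_∣ (≡.sym (ℚ.+-inverseʳ (seq x n)))) ε>0)

  pointwise-≤ : ∀ {x y} → (∀ n → seq x n ℚ.≤ seq y n) → x ≤ y
  pointwise-≤ {x} {y} h .below ε ε>0 = 0 , λ n _ → ℚ.≤-<-trans (h n)
    (≡.subst (ℚ._< seq y n ℚ.+ ε) (ℚ.+-identityʳ (seq y n)) (ℚ.+-monoʳ-< (seq y n) ε>0))

  ≈-refl : ∀ {x} → x ≈ x
  ≈-refl = pointwise-≈ λ n → ≡.refl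

  ≈-sym : ∀ {x y} → x ≈ y → y ≈ x
  ≈-sym {x} {y} h .null ε ε>0 = ev-map (λ n → ≡.subst (ℚ._< ε) (∣∣-flip (seq x n) (seq y n))) (null h ε ε>0)

  ≤-reflexive : ∀ {x y} → x ≈ y → x ≤ y
  ≤-reflexive h .below ε ε>0 = ev-map (λ n → ∣∣<⇒<) (null h ε ε>0)

  ≤-refl : ∀ {x} → x ≤ x
  ≤-refl = ≤-reflexive ≈-refl

  ≤-trans : ∀ {x y z} → x ≤ y → y ≤ z → x ≤ z
  ≤-trans {x} {y} {z} h k .below ε ε>0 = ev-map₂
    (λ n p q → ℚ.<-trans p (≡.subst (seq y n ℚ.+ ½ ℚ.* ε ℚ.<_)
      (≡.trans (ℚ.+-assoc (seq z n) (½ ℚ.* ε) (½ ℚ.* ε)) (≡.cong (seq z n ℚ.+_) (half+half ε)))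
      (ℚ.+-monoˡ-< (½ ℚ.* ε) q)))
    (below h (½ ℚ.* ε) (half>0 ε>0)) (below k (½ ℚ.* ε) (half>0 ε>0))

  ≤-antisym : ∀ {x y} → x ≤ y → y ≤ x → x ≈ y
  ≤-antisym {x} {y} h k .null ε ε>0 = ev-map₂ (λ n → <⇒∣∣<) (below h ε ε>0) (below k ε ε>0)

  ≈-trans : ∀ {x y z} → x ≈ y → y ≈ z → x ≈ z
  ≈-trans h k = ≤-antisym (≤-trans (≤-reflexive h) (≤-reflexive k))
                          (≤-trans (≤-reflexive (≈-sym k)) (≤-reflexive (≈-sym h)))

  ≈-isEquivalence : IsEquivalence _≈_
  ≈-isEquivalence = record { refl = ≈-refl ; sym = ≈-sym ; trans = ≈-trans }

  ≤-isPartialOrder : IsPartialOrder _≈_ _≤_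
  ≤-isPartialOrder = record
    { isPreorder = record { isEquivalence = ≈-isEquivalence ; reflexive = ≤-reflexive ; trans = ≤-trans }
    ; antisym    = ≤-antisym
    }

  ≤-poset : Poset 0ℓ 0ℓ 0ℓ
  ≤-poset = record { isPartialOrder = ≤-isPartialOrder }

  +-cong : ∀ {x x′ y y′} → x ≈ x′ → y ≈ y′ → x + y ≈ x′ + y′
  +-cong {x} {x′} {y} {y′} h k .null ε ε>0 = ev-map₂ (λ n → add-bound (seq x n) (seq y n) (seq x′ n) (seq y′ n) ε)
    (null h (½ ℚ.* ε) (half>0 ε>0)) (null k (½ ℚ.* ε) (half>0 ε>0))

  -‿cong : ∀ {x y} → x ≈ y → - x ≈ - y
  -‿cong {x} {y} h .null ε ε>0 = ev-map (λ n → neg-bound (seq x n) (seq y n)) (null h ε ε>0)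

  *-cong : ∀ {x x′ y y′} → x ≈ x′ → y ≈ y′ → x * y ≈ x′ * y′
  *-cong {x} {x′} {y} {y′} h k .null ε ε>0 =
    let A , A>0 , p = bounded (seq x) (cauchy x)
        B , B>0 , q = bounded (seq y′) (cauchy y′)
        δ , δ>0 , e = quotient (+>0 A>0 B>0) ε>0
    in ev-map₂
      (λ n (a , b) (c , d) → ≡.subst (ℚ.∣ seq x n ℚ.* seq y n ℚ.- seq x′ n ℚ.* seq y′ n ∣ ℚ.<_) e
        (mul-bound (seq x n) (seq y n) (seq x′ n) (seq y′ n) a b δ>0 c d))
      (ev-map₂ (λ n → _,_) p q)
      (ev-map₂ (λ n → _,_) (null h δ δ>0) (null k δ δ>0))

  ℝ-commutativeRing : CommutativeRing 0ℓ 0ℓ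
  ℝ-commutativeRing = record
    { Carrier = ℝ ; _≈_ = _≈_ ; _+_ = _+_ ; _*_ = _*_ ; -_ = -_ ; 0# = 0ᵣ ; 1# = 1ᵣ
    ; isCommutativeRing = record
      { isRing = record
        { +-isAbelianGroup = record
          { isGroup = record
            { isMonoid = record
              { isSemigroup = record
                { isMagma = record { isEquivalence = ≈-isEquivalence ; ∙-cong = +-cong }
                ; assoc   = λ x y z → pointwise-≈ λ n → ℚ.+-assoc (seq x n) (seq y n) (seq z n)
                }
              ; identity = (λ x → pointwise-≈ λ n → ℚ.+-identityˡ (seq x n))
                         , (λ x → pointwise-≈ λ n → ℚ.+-identityʳ (seq x n))
              }
            ; inverse = (λ x → pointwise-≈ λ n → ℚ.+-inverseˡ (seq x n))
                      , (λ x → pointwise-≈ λ n → ℚ.+-inverseʳ (seq x n))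
            ; ⁻¹-cong = -‿cong
            }
          ; comm = λ x y → pointwise-≈ λ n → ℚ.+-comm (seq x n) (seq y n)
          }
        ; *-cong     = *-cong
        ; *-assoc    = λ x y z → pointwise-≈ λ n → ℚ.*-assoc (seq x n) (seq y n) (seq z n)
        ; *-identity = (λ x → pointwise-≈ λ n → ℚ.*-identityˡ (seq x n))
                     , (λ x → pointwise-≈ λ n → ℚ.*-identityʳ (seq x n))
        ; distrib    = (λ x y z → pointwise-≈ λ n → ℚ.*-distribˡ-+ (seq x n) (seq y n) (seq z n))
                     , (λ x y z → pointwise-≈ λ n → ℚ.*-distribʳ-+ (seq x n) (seq y n) (seq z n))
        }
      ; *-comm = λ x y → pointwise-≈ λ n → ℚ.*-comm (seq x n) (seq y n)
      }
    }

  +-mono-≤ : ∀ {x x′ y y′} → x ≤ x′ → y ≤ y′ → x + y ≤ x′ + y′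
  +-mono-≤ {x} {x′} {y} {y′} h k .below ε ε>0 = ev-map₂
    (λ n p q → ≡.subst (seq x n ℚ.+ seq y n ℚ.<_)
      (≡.trans (solve 3 (λ a b e → (a ⊕ e) ⊕ (b ⊕ e) := (a ⊕ b) ⊕ (e ⊕ e)) ≡.refl (seq x′ n) (seq y′ n) (½ ℚ.* ε))
               (≡.cong (seq x′ n ℚ.+ seq y′ n ℚ.+_) (half+half ε)))
      (ℚ.+-mono-< p q))
    (below h (½ ℚ.* ε) (half>0 ε>0)) (below k (½ ℚ.* ε) (half>0 ε>0))

  x≤y⇒0≤y-x : ∀ {x y} → x ≤ y → 0ᵣ ≤ y - x
  x≤y⇒0≤y-x {x} {y} h = ≤-trans (≤-reflexive (pointwise-≈ λ n → ≡.sym (ℚ.+-inverseʳ (seq x n))))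
                                 (+-mono-≤ h (≤-refl { - x}))

  0≤y-x⇒x≤y : ∀ {x y} → 0ᵣ ≤ y - x → x ≤ y
  0≤y-x⇒x≤y {x} {y} h = ≤-trans (≤-reflexive (pointwise-≈ λ n → ≡.sym (ℚ.+-identityˡ (seq x n))))
    (≤-trans (+-mono-≤ h (≤-refl {x}))
      (≤-reflexive (pointwise-≈ λ n → solve 2 (λ x y → (y ⊖ x) ⊕ x := y) ≡.refl (seq x n) (seq y n))))

  -- From -δ < x and -δ < y follows -δ (x + y + δ) < x y; take δ ≤ 1 small compared with bounds for x and y.
  nonNeg-bound : ∀ {A B δ₀ ε} u v → 0ℚ ℚ.< A → 0ℚ ℚ.< B → 0ℚ ℚ.< δ₀ → (A ℚ.+ B ℚ.+ 1ℚ) ℚ.* δ₀ ≡ ε →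
                 ℚ.∣ u ∣ ℚ.< A → ℚ.∣ v ∣ ℚ.< B →
                 0ℚ ℚ.< u ℚ.+ (1ℚ ℚ.⊓ δ₀) → 0ℚ ℚ.< v ℚ.+ (1ℚ ℚ.⊓ δ₀) → 0ℚ ℚ.< u ℚ.* v ℚ.+ ε
  nonNeg-bound {A} {B} {δ₀} {ε} u v A>0 B>0 δ₀>0 e a b c d = ℚ.<-≤-trans
    (≡.subst (0ℚ ℚ.<_)
      (solve 3 (λ u v d → (u ⊕ d) ⊗ (v ⊕ d) := u ⊗ v ⊕ d ⊗ ((u ⊕ v) ⊕ d)) ≡.refl u v δ)
      (*>0 c d))
    (ℚ.+-monoʳ-≤ (u ℚ.* v) (ℚ.≤-trans
      (ℚ.*-monoˡ-≤-nonNeg δ {{ℚ.nonNegative (ℚ.<⇒≤ (1⊓>0 δ₀>0))}}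
        (ℚ.+-mono-≤ (ℚ.+-mono-≤ (ℚ.≤-trans (p≤∣p∣ u) (ℚ.<⇒≤ a)) (ℚ.≤-trans (p≤∣p∣ v) (ℚ.<⇒≤ b))) (ℚ.p⊓q≤p 1ℚ δ₀)))
      (ℚ.≤-trans
        (ℚ.*-monoʳ-≤-nonNeg C {{ℚ.nonNegative (ℚ.<⇒≤ (+>0 (+>0 A>0 B>0) 0<1))}} (ℚ.p⊓q≤q 1ℚ δ₀))
        (ℚ.≤-reflexive (≡.trans (ℚ.*-comm δ₀ C) e)))))
    where
    C = A ℚ.+ B ℚ.+ 1ℚ
    δ = 1ℚ ℚ.⊓ δ₀

  *-nonNeg : ∀ {x y} → 0ᵣ ≤ x → 0ᵣ ≤ y → 0ᵣ ≤ x * y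
  *-nonNeg {x} {y} h k .below ε ε>0 =
    let A , A>0 , p = bounded (seq x) (cauchy x)
        B , B>0 , q = bounded (seq y) (cauchy y)
        δ , δ>0 , e = quotient (+>0 (+>0 A>0 B>0) 0<1) ε>0
    in ev-map₂ (λ n (a , b) (c , d) → nonNeg-bound (seq x n) (seq y n) A>0 B>0 δ>0 e a b c d)
      (ev-map₂ (λ n → _,_) p q)
      (ev-map₂ (λ n → _,_) (below h _ (1⊓>0 δ>0)) (below k _ (1⊓>0 δ>0)))

  *-monoˡ-≤ : ∀ {x y z} → 0ᵣ ≤ x → y ≤ z → x * y ≤ x * z
  *-monoˡ-≤ {x} {y} {z} h k = 0≤y-x⇒x≤y (≤-trans (*-nonNeg h (x≤y⇒0≤y-x k))
    (≤-reflexive (pointwise-≈ λ n → solve 3 (λ x y z → x ⊗ (z ⊖ y) := x ⊗ z ⊖ x ⊗ y) ≡.refl (seq x n) (seq y n) (seq z n))))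

open Reals public using (ℝ; 0ᵣ; 1ᵣ; ℝ-commutativeRing)
  renaming (_≈_ to _≈ᵣ_; _≤_ to _≤ᵣ_; _+_ to _+ᵣ_; _-_ to _-ᵣ_; _*_ to _*ᵣ_)

module ℝ-Ring = CommutativeRing ℝ-commutativeRing
module ℝ-Sum = SemiringSum ℝ-Ring.semiring
open ℝ-Sum public using (sum; sum-syntax)

sum-mono : ∀ {n} {a b : Vector ℝ n} → (∀ i → a i ≤ᵣ b i) → sum a ≤ᵣ sum b
sum-mono {zero}  h = Reals.≤-refl
sum-mono {suc n} h = Reals.+-mono-≤ (h zero) (sum-mono λ i → h (suc i))

sum-nonNeg : ∀ {n} {a : Vector ℝ n} → (∀ i → 0ᵣ ≤ᵣ a i) → 0ᵣ ≤ᵣ sum a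
sum-nonNeg {n} h = Reals.≤-trans (Reals.≤-reflexive (ℝ-Ring.sym (ℝ-Sum.sum-replicate-zero n))) (sum-mono h)

δ : ∀ {n} → Fin n → Fin n → ℝ
δ zero    zero    = 1ᵣ
δ zero    (suc j) = 0ᵣ
δ (suc i) zero    = 0ᵣ
δ (suc i) (suc j) = δ i j

δ-nonNeg : ∀ {n} (i j : Fin n) → 0ᵣ ≤ᵣ δ i j
δ-nonNeg zero    zero    = Reals.pointwise-≤ λ _ → ℚ.<⇒≤ Reals.0<1
δ-nonNeg zero    (suc j) = Reals.≤-refl
δ-nonNeg (suc i) zero    = Reals.≤-refl
δ-nonNeg (suc i) (suc j) = δ-nonNeg i j

δ-sym : ∀ {n} (i j : Fin n) → δ i j ≡ δ j i
δ-sym zero    zero    = ≡.refl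
δ-sym zero    (suc j) = ≡.refl
δ-sym (suc i) zero    = ≡.refl
δ-sym (suc i) (suc j) = δ-sym i j

sum-zeroˡ : ∀ {n} (a : Vector ℝ n) → ∑[ j < n ] (0ᵣ *ᵣ a j) ≈ᵣ 0ᵣ
sum-zeroˡ {n} a = ℝ-Ring.trans (ℝ-Sum.sum-cong-≋ λ j → ℝ-Ring.zeroˡ (a j)) (ℝ-Sum.sum-replicate-zero n)

sum-δˡ : ∀ {n} (i : Fin n) (a : Vector ℝ n) → ∑[ j < n ] (δ i j *ᵣ a j) ≈ᵣ a i
sum-δˡ zero a = ℝ-Ring.trans
  (ℝ-Ring.+-cong (ℝ-Ring.*-identityˡ (a zero)) (sum-zeroˡ λ j → a (suc j)))
  (ℝ-Ring.+-identityʳ (a zero))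
sum-δˡ (suc i) a = ℝ-Ring.trans
  (ℝ-Ring.+-cong (ℝ-Ring.zeroˡ (a zero)) (sum-δˡ i λ j → a (suc j)))
  (ℝ-Ring.+-identityˡ (a (suc i)))

sum-δʳ : ∀ {n} (i : Fin n) (a : Vector ℝ n) → ∑[ j < n ] (a j *ᵣ δ j i) ≈ᵣ a i
sum-δʳ {n} i a = ℝ-Ring.trans
  (ℝ-Sum.sum-cong-≋ λ j → ℝ-Ring.trans (ℝ-Ring.*-comm (a j) (δ j i))
    (ℝ-Ring.*-congʳ (ℝ-Ring.reflexive (δ-sym j i))))
  (sum-δˡ i a)

sum-δ : ∀ {n} (i : Fin n) → sum (δ i) ≈ᵣ 1ᵣ
sum-δ i = ℝ-Ring.trans (ℝ-Sum.sum-cong-≋ λ j → ℝ-Ring.sym (ℝ-Ring.*-identityʳ (δ i j))) (sum-δˡ i λ _ → 1ᵣ)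

-- The product of the row vector r with the matrix s.

infixl 7 _⊛_

_⊛_ : ∀ {m n} → Vector ℝ m → (Fin m → Vector ℝ n) → Vector ℝ n
_⊛_ {m} r s j = ∑[ i < m ] (r i *ᵣ s i j)

⊛-cong : ∀ {m n} {r r′ : Vector ℝ m} {s s′ : Fin m → Vector ℝ n} → (∀ i → r i ≈ᵣ r′ i) →
         (∀ i j → s i j ≈ᵣ s′ i j) → ∀ j → (r ⊛ s) j ≈ᵣ (r′ ⊛ s′) j
⊛-cong h k j = ℝ-Sum.sum-cong-≋ λ i → ℝ-Ring.*-cong (h i) (k i j)

⊛-nonNeg : ∀ {m n} {r : Vector ℝ m} {s : Fin m → Vector ℝ n} → (∀ i → 0ᵣ ≤ᵣ r i) →
           (∀ i j → 0ᵣ ≤ᵣ s i j) → ∀ j → 0ᵣ ≤ᵣ (r ⊛ s) j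
⊛-nonNeg h k j = sum-nonNeg λ i → Reals.*-nonNeg (h i) (k i j)

⊛-mono : ∀ {m n} {r r′ : Vector ℝ m} {s s′ : Fin m → Vector ℝ n} → (∀ i → 0ᵣ ≤ᵣ r′ i) →
         (∀ i j → 0ᵣ ≤ᵣ s i j) → (∀ i → r i ≤ᵣ r′ i) → (∀ i j → s i j ≤ᵣ s′ i j) →
         ∀ j → (r ⊛ s) j ≤ᵣ (r′ ⊛ s′) j
⊛-mono {r = r} {r′} {s} {s′} r′≥0 s≥0 h k j = sum-mono λ i → Reals.≤-trans
  (Reals.≤-trans (Reals.≤-reflexive (ℝ-Ring.*-comm (r i) (s i j)))
    (Reals.≤-trans (Reals.*-monoˡ-≤ (s≥0 i j) (h i)) (Reals.≤-reflexive (ℝ-Ring.*-comm (s i j) (r′ i)))))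
  (Reals.*-monoˡ-≤ (r′≥0 i) (k i j))

sum-⊛ : ∀ {m n} (r : Vector ℝ m) (s : Fin m → Vector ℝ n) → sum (r ⊛ s) ≈ᵣ ∑[ i < m ] (r i *ᵣ sum (s i))
sum-⊛ {m} {n} r s = ℝ-Ring.trans (ℝ-Sum.∑-comm {n} {m} λ j i → r i *ᵣ s i j)
  (ℝ-Sum.sum-cong-≋ λ i → ℝ-Ring.sym (ℝ-Sum.*-distribˡ-sum (r i) (s i)))

⊛-assoc : ∀ {k m n} (r : Vector ℝ k) (s : Fin k → Vector ℝ m) (t : Fin m → Vector ℝ n) →
          ∀ j → (r ⊛ (λ i → s i ⊛ t)) j ≈ᵣ ((r ⊛ s) ⊛ t) j
⊛-assoc {k} {m} r s t j = begin
  ∑[ i < k ] (r i *ᵣ ∑[ l < m ] (s i l *ᵣ t l j))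
    ≈⟨ ℝ-Sum.sum-cong-≋ (λ i → ℝ-Sum.*-distribˡ-sum (r i) λ l → s i l *ᵣ t l j) ⟩
  ∑[ i < k ] ∑[ l < m ] (r i *ᵣ (s i l *ᵣ t l j))
    ≈⟨ ℝ-Sum.∑-comm (λ i l → r i *ᵣ (s i l *ᵣ t l j)) ⟩
  ∑[ l < m ] ∑[ i < k ] (r i *ᵣ (s i l *ᵣ t l j))
    ≈⟨ ℝ-Sum.sum-cong-≋ (λ l → ℝ-Sum.sum-cong-≋ λ i → ℝ-Ring.*-assoc (r i) (s i l) (t l j)) ⟨
  ∑[ l < m ] ∑[ i < k ] ((r i *ᵣ s i l) *ᵣ t l j)
    ≈⟨ ℝ-Sum.sum-cong-≋ (λ l → ℝ-Sum.*-distribʳ-sum (t l j) λ i → r i *ᵣ s i l) ⟨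
  ∑[ l < m ] ((∑[ i < k ] (r i *ᵣ s i l)) *ᵣ t l j)
    ∎
  where open ≈-Reasoning ℝ-Ring.setoid

record Simplex (m : ℕ) : Set where
  field
    weight : Vector ℝ m
    nonNeg : ∀ i → 0ᵣ ≤ᵣ weight i
    total  : sum weight ≈ᵣ 1ᵣ

-- That each entry is at most 1 follows from the other conditions.

record 𝓓∞≤1 (n : ℕ) : Set where
  field
    weight  : Vector ℝ n
    nonNeg  : ∀ i → 0ᵣ ≤ᵣ weight i
    total≤1 : sum weight ≤ᵣ 1ᵣ

dirac : ∀ {n} → Fin n → Simplex n
dirac i = record { weight = δ i ; nonNeg = δ-nonNeg i ; total = sum-δ i }

_⊛ˢ_ : ∀ {m n} → Simplex m → (Fin m → Simplex n) → Simplex n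
r ⊛ˢ s = record
  { weight = Simplex.weight r ⊛ λ i → Simplex.weight (s i)
  ; nonNeg = ⊛-nonNeg (Simplex.nonNeg r) λ i → Simplex.nonNeg (s i)
  ; total  = ℝ-Ring.trans (sum-⊛ (Simplex.weight r) λ i → Simplex.weight (s i))
      (ℝ-Ring.trans (ℝ-Sum.sum-cong-≋ λ i →
          ℝ-Ring.trans (ℝ-Ring.*-congˡ (Simplex.total (s i))) (ℝ-Ring.*-identityʳ (Simplex.weight r i)))
        (Simplex.total r))
  }

record UnitInterval : Set where
  field
    value : ℝ
    0≤    : 0ᵣ ≤ᵣ value
    ≤1    : value ≤ᵣ 1ᵣ

unitInterval : Poset 0ℓ 0ℓ 0ℓ
unitInterval = On.poset Reals.≤-poset UnitInterval.value

mix : UnitInterval → Simplex 2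
mix p = record
  { weight = value ∷ (1ᵣ -ᵣ value) ∷ []
  ; nonNeg = λ { zero → 0≤ ; (suc zero) → Reals.x≤y⇒0≤y-x ≤1 }
  ; total  = Reals.pointwise-≈ λ n → solve 1 (λ v → v :+ ((con 1ℚ :- v) :+ con 0ℚ) := con 1ℚ) ≡.refl (Reals.seq value n)
  }
  where open UnitInterval p
        open +-*-Solver using (solve; _:=_; con; _:+_; _:-_)

-- A directed subset is presented as a directed family; the level ι bounds the size of the index
-- types of the families under consideration.  Subsets of a carrier in Set ι are covered, since
-- they can be indexed by themselves.

module _ {c ℓ₁ ℓ₂} (P : Poset c ℓ₁ ℓ₂) where
  open Poset P

  record Directed {ι} {I : Set ι} (x : I → Carrier) : Set (ι ⊔ ℓ₂) where
    field
      inhabitant : I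
      bound      : ∀ i j → ∃ λ k → x i ≤ x k × x j ≤ x k

  record IsLub {ι} {I : Set ι} (x : I → Carrier) (s : Carrier) : Set (ι ⊔ c ⊔ ℓ₂) where
    field
      upper : ∀ i → x i ≤ s
      least : ∀ u → (∀ i → x i ≤ u) → s ≤ u

  DirectedComplete : ∀ ι → Set (lsuc ι ⊔ c ⊔ ℓ₂)
  DirectedComplete ι = ∀ {I : Set ι} (x : I → Carrier) → Directed x → ∃ (IsLub x)

  IsLeast : Carrier → Set (c ⊔ ℓ₂)
  IsLeast = Minimum _≤_

open Directed public
open IsLub public

module _ {c ℓ₁ ℓ₂ d m₁ m₂} (P : Poset c ℓ₁ ℓ₂) (Q : Poset d m₁ m₂) where
  private
    module P = Poset P
    module Q = Poset Q

  -- P need not be directed complete: all suprema of directed families which exist are preserved.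

  record ScottContinuous ι (f : P.Carrier → Q.Carrier) : Set (lsuc ι ⊔ c ⊔ ℓ₂ ⊔ d ⊔ m₂) where
    field
      mono    : f Preserves P._≤_ ⟶ Q._≤_
      pres-⨆ : ∀ {I : Set ι} {x : I → P.Carrier} {s} → Directed P x → IsLub P x s → IsLub Q (λ i → f (x i)) (f s)

    cong : f Preserves P._≈_ ⟶ Q._≈_
    cong e = Q.antisym (mono (P.reflexive e)) (mono (P.reflexive (P.Eq.sym e)))

  Strict : (P.Carrier → Q.Carrier) → Set (c ⊔ ℓ₂ ⊔ d ⊔ m₂)
  Strict f = ∀ {x} → IsLeast P x → IsLeast Q (f x)

open ScottContinuous public

pointwise : ∀ {i c ℓ₁ ℓ₂} → Set i → Poset c ℓ₁ ℓ₂ → Poset (i ⊔ c) (i ⊔ ℓ₁) (i ⊔ ℓ₂)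
pointwise I P = record
  { Carrier = I → Carrier
  ; _≈_ = λ x y → ∀ i → x i ≈ y i
  ; _≤_ = λ x y → ∀ i → x i ≤ y i
  ; isPartialOrder = record
    { isPreorder = record
      { isEquivalence = record
        { refl  = λ i → Eq.refl
        ; sym   = λ h i → Eq.sym (h i)
        ; trans = λ h k i → Eq.trans (h i) (k i)
        }
      ; reflexive = λ h i → reflexive (h i)
      ; trans     = λ h k i → trans (h i) (k i)
      }
    ; antisym = λ h k i → antisym (h i) (k i)
    }
  }
  where open Poset P

record Dcpo ℓ : Set (lsuc ℓ) where
  field
    poset            : Poset ℓ ℓ ℓ
    directedComplete : DirectedComplete poset ℓ
  open Poset poset public

record PointedDcpo ℓ : Set (lsuc ℓ) where
  field
    dcpo    : Dcpo ℓ
  open Dcpo dcpo public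
  field
    ⊥       : Carrier
    ⊥-least : IsLeast poset ⊥

record Category o h e : Set (lsuc (o ⊔ h ⊔ e)) where
  infix  4 _≈_ _⇒_
  infixr 9 _∘_
  field
    Obj       : Set o
    _⇒_       : Obj → Obj → Set h
    _≈_       : ∀ {A B} → A ⇒ B → A ⇒ B → Set e
    id        : ∀ {A} → A ⇒ A
    _∘_       : ∀ {A B C} → B ⇒ C → A ⇒ B → A ⇒ C
    equiv     : ∀ {A B} → IsEquivalence (_≈_ {A} {B})
    ∘-cong    : ∀ {A B C} {f f′ : B ⇒ C} {g g′ : A ⇒ B} → f ≈ f′ → g ≈ g′ → f ∘ g ≈ f′ ∘ g′
    assoc     : ∀ {A B C D} {f : C ⇒ D} {g : B ⇒ C} {h : A ⇒ B} → (f ∘ g) ∘ h ≈ f ∘ (g ∘ h)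
    identityˡ : ∀ {A B} {f : A ⇒ B} → id ∘ f ≈ f
    identityʳ : ∀ {A B} {f : A ⇒ B} → f ∘ id ≈ f

  module Equiv {A B} = IsEquivalence (equiv {A} {B})

  hom-setoid : Obj → Obj → Setoid h e
  hom-setoid A B = record { isEquivalence = equiv {A} {B} }

module _ {o h e} (𝓒 : Category o h e) where
  open Category 𝓒

  IsTerminal : Obj → Set (o ⊔ h ⊔ e)
  IsTerminal T = ∀ X → ∃ λ (f : X ⇒ T) → ∀ g → f ≈ g

  IsProduct : ∀ {A B P} → P ⇒ A → P ⇒ B → Set (o ⊔ h ⊔ e)
  IsProduct {A} {B} {P} π₁ π₂ = ∀ {X} (f : X ⇒ A) (g : X ⇒ B) →
    ∃! _≈_ λ (k : X ⇒ P) → π₁ ∘ k ≈ f × π₂ ∘ k ≈ g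

record Functor {o h e o′ h′ e′} (𝓒 : Category o h e) (𝓓 : Category o′ h′ e′) :
               Set (o ⊔ h ⊔ e ⊔ o′ ⊔ h′ ⊔ e′) where
  private
    module 𝓒 = Category 𝓒
    module 𝓓 = Category 𝓓
  field
    F₀       : 𝓒.Obj → 𝓓.Obj
    F₁       : ∀ {A B} → A 𝓒.⇒ B → F₀ A 𝓓.⇒ F₀ B
    F-cong   : ∀ {A B} {f g : A 𝓒.⇒ B} → f 𝓒.≈ g → F₁ f 𝓓.≈ F₁ g
    F-id     : ∀ {A} → F₁ (𝓒.id {A}) 𝓓.≈ 𝓓.id
    F-∘      : ∀ {A B C} {f : B 𝓒.⇒ C} {g : A 𝓒.⇒ B} → F₁ (f 𝓒.∘ g) 𝓓.≈ F₁ f 𝓓.∘ F₁ g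

module _ {o h e} {𝓒 : Category o h e} where
  open Category 𝓒

  idF : Functor 𝓒 𝓒
  idF = record { F₀ = λ A → A ; F₁ = λ f → f ; F-cong = λ h → h ; F-id = Equiv.refl ; F-∘ = Equiv.refl }

module _ {o h e o′ h′ e′ o″ h″ e″} {𝓒 : Category o h e} {𝓓 : Category o′ h′ e′} {𝓔 : Category o″ h″ e″} where
  private
    module 𝓔 = Category 𝓔

  infixr 9 _∘F_

  _∘F_ : Functor 𝓓 𝓔 → Functor 𝓒 𝓓 → Functor 𝓒 𝓔
  G ∘F F = record
    { F₀     = λ A → G.F₀ (F.F₀ A)
    ; F₁     = λ f → G.F₁ (F.F₁ f)
    ; F-cong = λ h → G.F-cong (F.F-cong h)
    ; F-id   = 𝓔.Equiv.trans (G.F-cong F.F-id) G.F-id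
    ; F-∘    = 𝓔.Equiv.trans (G.F-cong F.F-∘) G.F-∘
    }
    where
    module G = Functor G
    module F = Functor F

module _ {o h e o′ h′ e′} {𝓒 : Category o h e} {𝓓 : Category o′ h′ e′} where
  private
    module 𝓒 = Category 𝓒
    module 𝓓 = Category 𝓓

  record NaturalTransformation (F G : Functor 𝓒 𝓓) : Set (o ⊔ h ⊔ h′ ⊔ e′) where
    private
      module F = Functor F
      module G = Functor G
    field
      η       : ∀ A → F.F₀ A 𝓓.⇒ G.F₀ A
      natural : ∀ {A B} (f : A 𝓒.⇒ B) → η B 𝓓.∘ F.F₁ f 𝓓.≈ G.F₁ f 𝓓.∘ η A

  record NaturalIsomorphism (F G : Functor 𝓒 𝓓) : Set (o ⊔ h ⊔ h′ ⊔ e′) where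
    field
      to : NaturalTransformation F G
    open NaturalTransformation to public
    field
      η⁻¹  : ∀ A → Functor.F₀ G A 𝓓.⇒ Functor.F₀ F A
      isoˡ : ∀ A → η⁻¹ A 𝓓.∘ η A 𝓓.≈ 𝓓.id
      isoʳ : ∀ A → η A 𝓓.∘ η⁻¹ A 𝓓.≈ 𝓓.id

infix 4 _≃_

record _≃_ {o h e o′ h′ e′} (𝓒 : Category o h e) (𝓓 : Category o′ h′ e′) :
       Set (o ⊔ h ⊔ e ⊔ o′ ⊔ h′ ⊔ e′) where
  field
    F      : Functor 𝓒 𝓓
    G      : Functor 𝓓 𝓒
    unit   : NaturalIsomorphism idF (G ∘F F)
    counit : NaturalIsomorphism (F ∘F G) idF

module _ {o h e} {𝓒 : Category o h e} (F : Functor 𝓒 𝓒) where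
  open Category 𝓒
  open Functor F

  IsInitialAlgebra : ∀ {A} → F₀ A ⇒ A → Set (o ⊔ h ⊔ e)
  IsInitialAlgebra {A} α = ∀ {B} (β : F₀ B ⇒ B) → ∃! _≈_ λ (k : A ⇒ B) → k ∘ α ≈ β ∘ F₁ k

  IsFinalCoalgebra : ∀ {A} → A ⇒ F₀ A → Set (o ⊔ h ⊔ e)
  IsFinalCoalgebra {A} α = ∀ {B} (β : B ⇒ F₀ B) → ∃! _≈_ λ (k : B ⇒ A) → α ∘ k ≈ F₁ k ∘ β

  record CanonicalFixpoint : Set (o ⊔ h ⊔ e) where
    field
      μF      : Obj
      fold    : F₀ μF ⇒ μF
      unfold  : μF ⇒ F₀ μF
      isoˡ    : unfold ∘ fold ≈ id
      isoʳ    : fold ∘ unfold ≈ id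
      initial : IsInitialAlgebra fold
      final   : IsFinalCoalgebra unfold

AlgebraicallyCompact : ∀ {o h e p} (𝓒 : Category o h e) → (Functor 𝓒 𝓒 → Set p) → Set (o ⊔ h ⊔ e ⊔ p)
AlgebraicallyCompact 𝓒 𝓛 = (F : Functor 𝓒 𝓒) → 𝓛 F → CanonicalFixpoint F

record PosetCategory o h₁ h₂ h₃ : Set (lsuc (o ⊔ h₁ ⊔ h₂ ⊔ h₃)) where
  infixr 9 _∘_
  field
    Obj : Set o
    Hom : Obj → Obj → Poset h₁ h₂ h₃
  private
    module Hom {A B} = Poset (Hom A B)
  _⇒_ : Obj → Obj → Set h₁
  A ⇒ B = Poset.Carrier (Hom A B)
  field
    id        : ∀ {A} → A ⇒ A
    _∘_       : ∀ {A B C} → B ⇒ C → A ⇒ B → A ⇒ C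
    ∘-mono    : ∀ {A B C} {f f′ : B ⇒ C} {g g′ : A ⇒ B} → f Hom.≤ f′ → g Hom.≤ g′ → (f ∘ g) Hom.≤ (f′ ∘ g′)
    assoc     : ∀ {A B C D} {f : C ⇒ D} {g : B ⇒ C} {h : A ⇒ B} → ((f ∘ g) ∘ h) Hom.≈ (f ∘ (g ∘ h))
    identityˡ : ∀ {A B} {f : A ⇒ B} → (id ∘ f) Hom.≈ f
    identityʳ : ∀ {A B} {f : A ⇒ B} → (f ∘ id) Hom.≈ f

  category : Category o h₁ h₂
  category = record
    { Obj = Obj ; _⇒_ = _⇒_ ; _≈_ = Hom._≈_ ; id = id ; _∘_ = _∘_
    ; equiv  = Hom.isEquivalence
    ; ∘-cong = λ h k → Hom.antisym (∘-mono (Hom.reflexive h) (Hom.reflexive k))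
                                   (∘-mono (Hom.reflexive (Hom.Eq.sym h)) (Hom.reflexive (Hom.Eq.sym k)))
    ; assoc = assoc ; identityˡ = identityˡ ; identityʳ = identityʳ
    }

-- Enrichment over pointed dcpos and strict Scott-continuous maps with their smash product, so that
-- composition is strict and Scott-continuous in each variable.  The type of Scott-continuous maps
-- between dcpos in Set ι lies in Set (lsuc ι), but its directed families are still indexed by Set ι.

record Dcpo⊥!-Category o h₁ h₂ h₃ ι : Set (lsuc (o ⊔ h₁ ⊔ h₂ ⊔ h₃ ⊔ ι)) where
  field
    posetCategory : PosetCategory o h₁ h₂ h₃
  open PosetCategory posetCategory public
  field
    hom-directedComplete : ∀ {A B} → DirectedComplete (Hom A B) ι
    ⊥ʰ       : ∀ {A B} → A ⇒ B
    ⊥ʰ-least : ∀ {A B} → IsLeast (Hom A B) ⊥ʰ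
    ∘-strictˡ : ∀ {A B C} (g : A ⇒ B) → Strict (Hom B C) (Hom A C) (_∘ g)
    ∘-strictʳ : ∀ {A B C} (f : B ⇒ C) → Strict (Hom A B) (Hom A C) (f ∘_)
    ∘-scottˡ  : ∀ {A B C} (g : A ⇒ B) → ScottContinuous (Hom B C) (Hom A C) ι (_∘ g)
    ∘-scottʳ  : ∀ {A B C} (f : B ⇒ C) → ScottContinuous (Hom A B) (Hom A C) ι (f ∘_)

module _ {o h₁ h₂ h₃ ι} (𝓒 : Dcpo⊥!-Category o h₁ h₂ h₃ ι) where
  open Dcpo⊥!-Category 𝓒

  LocallyContinuous : Functor category category → Set (o ⊔ h₁ ⊔ h₃ ⊔ lsuc ι)
  LocallyContinuous F = ∀ {A B} → ScottContinuous (Hom A B) (Hom (F₀ A) (F₀ B)) ι F₁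
    where open Functor F

module _ {o h₁ h₂ h₃ o′ h₁′ h₂′ h₃′} (ι : Level)
         (𝓒 : PosetCategory o h₁ h₂ h₃) (𝓓 : PosetCategory o′ h₁′ h₂′ h₃′) where
  private
    module 𝓒 = PosetCategory 𝓒
    module 𝓓 = PosetCategory 𝓓
    open Category 𝓓.category using (module Equiv; ∘-cong)

  record ProductFunctor : Set (lsuc ι ⊔ o ⊔ h₁ ⊔ h₂ ⊔ h₃ ⊔ o′ ⊔ h₁′ ⊔ h₂′ ⊔ h₃′) where
    field
      functor : Functor 𝓒.category 𝓓.category
    open Functor functor public
    field
      strict        : ∀ {A B} → Strict (𝓒.Hom A B) (𝓓.Hom (F₀ A) (F₀ B)) F₁
      scott         : ∀ {A B} → ScottContinuous (𝓒.Hom A B) (𝓓.Hom (F₀ A) (F₀ B)) ι F₁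
      pres-terminal : ∀ {T} → IsTerminal 𝓒.category T → IsTerminal 𝓓.category (F₀ T)
      pres-product  : ∀ {A B P} {π₁ : P 𝓒.⇒ A} {π₂ : P 𝓒.⇒ B} →
                      IsProduct 𝓒.category π₁ π₂ → IsProduct 𝓓.category (F₁ π₁) (F₁ π₂)

  [_,_,_]ₓ : Category _ _ _
  [_,_,_]ₓ = record
    { Obj    = ProductFunctor
    ; _⇒_    = λ F G → NaturalTransformation (functor F) (functor G)
    ; _≈_    = λ α β → ∀ A → η α A 𝓓≈ η β A
    ; id     = record { η = λ A → 𝓓.id ; natural = λ f → Equiv.trans 𝓓.identityˡ (Equiv.sym 𝓓.identityʳ) }
    ; _∘_    = λ α β → record
        { η       = λ A → η α A 𝓓.∘ η β A
        ; natural = λ f → Equiv.trans 𝓓.assoc (Equiv.trans (∘-cong Equiv.refl (natural β f))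
            (Equiv.trans (Equiv.sym 𝓓.assoc) (Equiv.trans (∘-cong (natural α f) Equiv.refl) 𝓓.assoc)))
        }
    ; equiv  = record
        { refl  = λ A → Equiv.refl
        ; sym   = λ h A → Equiv.sym (h A)
        ; trans = λ h k A → Equiv.trans (h A) (k A)
        }
    ; ∘-cong    = λ h k A → ∘-cong (h A) (k A)
    ; assoc     = λ A → 𝓓.assoc
    ; identityˡ = λ A → 𝓓.identityˡ
    ; identityʳ = λ A → 𝓓.identityʳ
    }
    where
    open ProductFunctor using (functor)
    open NaturalTransformation
    open Category 𝓓.category using () renaming (_≈_ to _𝓓≈_)

-- A morphism f : n ⇒ m is an m-tuple of subdistributions on n.

𝕃≤1 : PosetCategory 0ℓ 0ℓ 0ℓ 0ℓ
𝕃≤1 = record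
  { Obj = ℕ
  ; Hom = λ n m → pointwise (Fin m) (On.poset (pointwise (Fin n) Reals.≤-poset) weight)
  ; id  = λ k → record { weight = δ k ; nonNeg = δ-nonNeg k ; total≤1 = Reals.≤-reflexive (sum-δ k) }
  ; _∘_ = λ g f k → record
      { weight  = weight (g k) ⊛ λ j → weight (f j)
      ; nonNeg  = ⊛-nonNeg (nonNeg (g k)) λ j → nonNeg (f j)
      ; total≤1 = Reals.≤-trans (Reals.≤-reflexive (sum-⊛ (weight (g k)) λ j → weight (f j)))
          (Reals.≤-trans (sum-mono λ j → Reals.≤-trans (Reals.*-monoˡ-≤ (nonNeg (g k) j) (total≤1 (f j)))
                                           (Reals.≤-reflexive (ℝ-Ring.*-identityʳ (weight (g k) j))))
            (total≤1 (g k)))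
      }
  ; ∘-mono = λ {_} {_} {_} {g} {g′} {f} {f′} h k p → ⊛-mono (nonNeg (g′ p)) (λ j → nonNeg (f j)) (h p) k
  ; assoc = λ {_} {_} {_} {_} {h} {g} {f} k i → ℝ-Ring.sym
      (⊛-assoc (weight (h k)) (λ l → weight (g l)) (λ j → weight (f j)) i)
  ; identityˡ = λ {_} {_} {f} k i → sum-δˡ k λ j → weight (f j) i
  ; identityʳ = λ {_} {_} {g} k i → sum-δʳ i (weight (g k))
  }
  where open 𝓓∞≤1

module _ {c ℓ₁ ℓ₂} {P : Poset c ℓ₁ ℓ₂} where
  scott-id : ∀ {ι} → ScottContinuous P P ι (λ x → x)
  scott-id .mono h = h
  scott-id .pres-⨆ _ l = l

  Directed-map : ∀ {d m₁ m₂ ι} {Q : Poset d m₁ m₂} {I : Set ι} {f : Poset.Carrier P → Poset.Carrier Q}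
                 {x : I → Poset.Carrier P} →
                 f Preserves Poset._≤_ P ⟶ Poset._≤_ Q → Directed P x → Directed Q (λ i → f (x i))
  Directed-map h D .inhabitant = inhabitant D
  Directed-map h D .bound i j = let k , p , q = bound D i j in k , h p , h q

module _ {c ℓ₁ ℓ₂ d m₁ m₂ e n₁ n₂} {P : Poset c ℓ₁ ℓ₂} {Q : Poset d m₁ m₂} {R : Poset e n₁ n₂} where
  scott-∘ : ∀ {ι g f} → ScottContinuous Q R ι g → ScottContinuous P Q ι f → ScottContinuous P R ι (λ x → g (f x))
  scott-∘ G F .mono h = G .mono (F .mono h)
  scott-∘ G F .pres-⨆ D l = G .pres-⨆ (Directed-map {P = P} {Q = Q} (F .mono) D) (F .pres-⨆ D l)

module _ (ℓ : Level) where
  open PointedDcpo {ℓ}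

  record StrictScottMap (X Y : PointedDcpo ℓ) : Set (lsuc ℓ) where
    field
      fun    : Carrier X → Carrier Y
      strict : Strict (poset X) (poset Y) fun
      scott  : ScottContinuous (poset X) (poset Y) ℓ fun

  open StrictScottMap

  Dcpo⊥! : PosetCategory (lsuc ℓ) (lsuc ℓ) ℓ ℓ
  Dcpo⊥! = record
    { Obj = PointedDcpo ℓ
    ; Hom = λ X Y → On.poset (pointwise (Carrier X) (poset Y)) (fun {X} {Y})
    ; id  = λ {X} → record { fun = λ x → x ; strict = λ h → h ; scott = scott-id {P = poset X} }
    ; _∘_ = λ g f → record
        { fun    = λ x → fun g (fun f x)
        ; strict = λ h → strict g (strict f h)
        ; scott  = scott-∘ (scott g) (scott f)
        }
    ; ∘-mono    = λ {_} {_} {Z} {g} {_} {_} {f′} h k x → trans Z (mono (scott g) (k x)) (h (fun f′ x))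
    ; assoc     = λ {_} {_} {_} {Z} x → Eq.refl Z
    ; identityˡ = λ {_} {Y} x → Eq.refl Y
    ; identityʳ = λ {_} {Y} x → Eq.refl Y
    }

record ConvexStructure {c ℓ} (X : Setoid c ℓ) : Set (c ⊔ ℓ) where
  open Setoid X
  field
    combine       : ∀ {m} → Simplex m → Vector Carrier m → Carrier
    combine-cong  : ∀ {m} {r s : Simplex m} {x y : Vector Carrier m} →
                    (∀ i → Simplex.weight r i ≈ᵣ Simplex.weight s i) → (∀ i → x i ≈ y i) →
                    combine r x ≈ combine s y
    combine-dirac : ∀ {m} (i : Fin m) (x : Vector Carrier m) → combine (dirac i) x ≈ x i
    combine-⊛     : ∀ {m n} (r : Simplex m) (s : Fin m → Simplex n) (x : Vector Carrier n) →
                    combine r (λ i → combine (s i) x) ≈ combine (r ⊛ˢ s) x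

  infixl 6 _⊕[_]_

  _⊕[_]_ : Carrier → UnitInterval → Carrier → Carrier
  x ⊕[ p ] y = combine (mix p) (x ∷ y ∷ [])

  combine-const : ∀ {m} (r : Simplex m) (x : Carrier) → combine r (λ _ → x) ≈ x
  combine-const {m} r x = begin
    combine r (λ _ → x)                                    ≈⟨ combine-cong (λ _ → ℝ-Ring.refl) (λ _ → combine-dirac zero x₁) ⟨
    combine r (λ _ → combine (dirac zero) x₁)              ≈⟨ combine-⊛ r (λ _ → dirac zero) x₁ ⟩
    combine (r ⊛ˢ λ _ → dirac zero) x₁                     ≈⟨ combine-cong weights (λ _ → refl) ⟩
    combine (dirac zero) x₁                                ≈⟨ combine-dirac zero x₁ ⟩
    x                                                      ∎
    where
    open ≈-Reasoning X
    x₁ : Vector Carrier 1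
    x₁ _ = x
    weights : ∀ (j : Fin 1) → (Simplex.weight r ⊛ λ _ → δ zero) j ≈ᵣ δ zero j
    weights zero = ℝ-Ring.trans (ℝ-Sum.sum-cong-≋ λ i → ℝ-Ring.*-identityʳ (Simplex.weight r i)) (Simplex.total r)

record ConvexDcpo ℓ : Set (lsuc ℓ) where
  field
    dcpo   : Dcpo ℓ
  open Dcpo dcpo public
  field
    convex : ConvexStructure Eq.setoid
  open ConvexStructure convex public
  field
    combine-scott : ∀ {m} (r : Simplex m) → ScottContinuous (pointwise (Fin m) poset) poset ℓ (combine r)

record PointedConvexDcpo ℓ : Set (lsuc ℓ) where
  field
    convexDcpo : ConvexDcpo ℓ
  open ConvexDcpo convexDcpo public
  field
    ⊥       : Carrier
    ⊥-least : IsLeast poset ⊥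

  infixr 7 _·_

  _·_ : UnitInterval → Carrier → Carrier
  p · x = x ⊕[ p ] ⊥

record Kegelspitze ℓ : Set (lsuc ℓ) where
  field
    pointedConvexDcpo : PointedConvexDcpo ℓ
  open PointedConvexDcpo pointedConvexDcpo public
  field
    ·-scottˡ : ∀ x → ScottContinuous unitInterval poset ℓ (_· x)
    ·-scottʳ : ∀ p → ScottContinuous poset poset ℓ (p ·_)

module _ {ℓ : Level} where
  open Kegelspitze {ℓ}

  record AffineScottMap (X Y : Kegelspitze ℓ) : Set (lsuc ℓ) where
    private
      module X = Kegelspitze X
      module Y = Kegelspitze Y
    field
      fun    : X.Carrier → Y.Carrier
      affine : ∀ {m} (r : Simplex m) (x : Vector X.Carrier m) →
               fun (X.combine r x) Y.≈ Y.combine r (λ i → fun (x i))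
      strict : Strict X.poset Y.poset fun
      scott  : ScottContinuous X.poset Y.poset ℓ fun

  open AffineScottMap

  KS-Hom : Kegelspitze ℓ → Kegelspitze ℓ → Poset (lsuc ℓ) ℓ ℓ
  KS-Hom X Y = On.poset (pointwise (Carrier X) (poset Y)) (fun {X} {Y})

  ⊥ᵏ : ∀ {X Y} → AffineScottMap X Y
  ⊥ᵏ {X} {Y} = record
    { fun    = λ _ → ⊥ Y
    ; affine = λ r _ → Eq.sym Y (combine-const Y r (⊥ Y))
    ; strict = λ _ → ⊥-least Y
    ; scott  = record
        { mono   = λ _ → refl Y
        ; pres-⨆ = λ D _ → record { upper = λ _ → refl Y ; least = λ u h → h (inhabitant D) }
        }
    }

  KS-posetCategory : PosetCategory (lsuc ℓ) (lsuc ℓ) ℓ ℓ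
  KS-posetCategory = record
    { Obj = Kegelspitze ℓ
    ; Hom = KS-Hom
    ; id  = λ {X} → record
        { fun = λ x → x ; affine = λ _ _ → Eq.refl X ; strict = λ h → h ; scott = scott-id {P = poset X} }
    ; _∘_ = λ {X} {Y} {Z} g f → record
        { fun    = λ x → fun g (fun f x)
        ; affine = λ r x → Eq.trans Z (cong (scott g) (affine f r x)) (affine g r λ i → fun f (x i))
        ; strict = λ h → strict g (strict f h)
        ; scott  = scott-∘ (scott g) (scott f)
        }
    ; ∘-mono    = λ {_} {_} {Z} {g} {_} {_} {f′} h k x → trans Z (mono (scott g) (k x)) (h (fun f′ x))
    ; assoc     = λ {_} {_} {_} {Z} x → Eq.refl Z
    ; identityˡ = λ {_} {Y} x → Eq.refl Y
    ; identityʳ = λ {_} {Y} x → Eq.refl Y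
    }

  module _ {X Y : Kegelspitze ℓ} {I : Set ℓ} {f : I → AffineScottMap X Y} (D : Directed (KS-Hom X Y) f) where
    private
      module X = Kegelspitze X
      module Y = Kegelspitze Y

      Dₓ : ∀ x → Directed Y.poset (λ i → fun (f i) x)
      Dₓ x .inhabitant = inhabitant D
      Dₓ x .bound i j = let k , p , q = bound D i j in k , p x , q x

      sup : X.Carrier → Y.Carrier
      sup x = proj₁ (Y.directedComplete (λ i → fun (f i) x) (Dₓ x))

      sup-lub : ∀ x → IsLub Y.poset (λ i → fun (f i) x) (sup x)
      sup-lub x = proj₂ (Y.directedComplete (λ i → fun (f i) x) (Dₓ x))

      sup-mono : sup Preserves X._≤_ ⟶ Y._≤_
      sup-mono {x} {y} h = least (sup-lub x) _ λ i → Y.trans (mono (scott (f i)) h) (upper (sup-lub y) i)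

      sup-affine : ∀ {m} (r : Simplex m) (x : Vector X.Carrier m) →
                   sup (X.combine r x) Y.≈ Y.combine r (λ k → sup (x k))
      sup-affine r x = Y.antisym
        (least (sup-lub (X.combine r x)) _ λ i → Y.trans (Y.reflexive (affine (f i) r x)) (upper lub i))
        (least lub _ λ i → Y.trans (Y.reflexive (Y.Eq.sym (affine (f i) r x))) (upper (sup-lub (X.combine r x)) i))
        where
        lub : IsLub Y.poset (λ i → Y.combine r (λ k → fun (f i) (x k))) (Y.combine r (λ k → sup (x k)))
        lub = pres-⨆ (Y.combine-scott r)
          (record { inhabitant = inhabitant D
                  ; bound = λ i j → let k , p , q = bound D i j in k , (λ l → p (x l)) , (λ l → q (x l)) })
          (record { upper = λ i k → upper (sup-lub (x k)) i
                  ; least = λ u h k → least (sup-lub (x k)) (u k) λ i → h i k })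

    ⨆ᵏ : AffineScottMap X Y
    ⨆ᵏ = record
      { fun    = sup
      ; affine = sup-affine
      ; strict = λ {x} h y → least (sup-lub x) y λ i → strict (f i) h y
      ; scott  = record
          { mono   = sup-mono
          ; pres-⨆ = λ {J} {x} {s} E l → record
              { upper = λ j → sup-mono (upper l j)
              ; least = λ u h → least (sup-lub s) u λ i →
                  least (pres-⨆ (scott (f i)) E l) u λ j → Y.trans (upper (sup-lub (x j)) i) (h j)
              }
          }
      }

    ⨆ᵏ-lub : IsLub (KS-Hom X Y) f ⨆ᵏ
    ⨆ᵏ-lub .upper i x   = upper (sup-lub x) i
    ⨆ᵏ-lub .least u h x = least (sup-lub x) (fun u x) λ i → h i x

    KS-lub-pointwise : ∀ {g} → IsLub (KS-Hom X Y) f g → ∀ x → IsLub Y.poset (λ i → fun (f i) x) (fun g x)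
    KS-lub-pointwise l x .upper i   = upper l i x
    KS-lub-pointwise l x .least u h = Y.trans (least l ⨆ᵏ (upper ⨆ᵏ-lub) x) (least (sup-lub x) u h)

  KS-least-pointwise : ∀ {X Y g} → IsLeast (KS-Hom X Y) g → ∀ x → IsLeast (poset Y) (fun g x)
  KS-least-pointwise {X} {Y} h x y = trans Y (h (⊥ᵏ {X} {Y}) x) (⊥-least Y y)

KS : ∀ ℓ → Dcpo⊥!-Category (lsuc ℓ) (lsuc ℓ) ℓ ℓ ℓ
KS ℓ = record
  { posetCategory = KS-posetCategory
  ; hom-directedComplete = λ f D → ⨆ᵏ D , ⨆ᵏ-lub D
  ; ⊥ʰ        = ⊥ᵏ
  ; ⊥ʰ-least  = λ {_} {Y} f x → ⊥-least Y (fun f x)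
  ; ∘-strictˡ = λ g {f} h k x → KS-least-pointwise {g = f} h (fun g x) (fun k x)
  ; ∘-strictʳ = λ g {f} h k x → strict g (KS-least-pointwise {g = f} h x) (fun k x)
  ; ∘-scottˡ  = λ g → record
      { mono   = λ h x → h (fun g x)
      ; pres-⨆ = λ {_} {f} D l → record
          { upper = λ i x → upper l i (fun g x)
          ; least = λ u h x → least (KS-lub-pointwise {f = f} D l (fun g x)) (fun u x) λ i → h i x
          }
      }
  ; ∘-scottʳ  = λ {X} {Y} {Z} g → record
      { mono   = λ h x → mono (scott g) (h x)
      ; pres-⨆ = λ {_} {f} D l → record
          { upper = λ i x → mono (scott g) (upper l i x)
          ; least = λ u h x → least
              (pres-⨆ (scott g)
                (record { inhabitant = inhabitant D
                        ; bound = λ i j → let k , p , q = bound D i j in k , p x , q x })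
                (KS-lub-pointwise {f = f} D l x))
              (fun u x) λ i → h i x
          }
      }
  }
  where
  open Kegelspitze
  open AffineScottMap

{-# OPTIONS --safe #-}
module Submission where

-- A Kegelspitze K gives the functor n ↦ Kⁿ, on which a matrix of subdistributions acts by subconvex
-- combinations.  Conversely, a product-preserving functor Φ gives a convex structure on Φ 1, since
-- Φ n ≅ (Φ 1)ⁿ.  The only analytic point is that Σ rᵢ xᵢ is Scott-continuous in r: halving makes room
-- for splitting off one summand, so that ½ Σ rᵢ xᵢ is continuous by induction, and ½ x ≤ ½ y implies
-- x ≤ y, because it implies λ x ≤ λ y for scalars λ arbitrarily close to 1.
--
-- A locally continuous F has a fixpoint D, the bilimit of the chain Fⁿ 0 of embedding-projection pairs.
-- The identity of D is the least fixpoint of h ↦ fold ∘ F h ∘ unfold, and this makes D both an initial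
-- algebra and a final coalgebra.

open import Defs
import Algebra.Properties.AbelianGroup as AbelianGroupProperties
open import Data.Fin.Base using (Fin; zero; suc; _↑ˡ_; _↑ʳ_; splitAt)
import Data.Fin.Properties as Fin
open import Data.Integer.Base as ℤ using (+_; +[1+_]; -[1+_])
open import Data.Nat.Base as ℕ using (ℕ; zero; suc; z≤n; s≤s)
import Data.Nat.Coprimality as Coprimality
import Data.Nat.Properties as ℕ
import Data.Nat.Solver as ℕ-Solver
open import Data.Product using (∃; _×_; _,_; proj₁; proj₂)
open import Data.Rational as ℚ using (ℚ; 0ℚ; 1ℚ; ½; mkℚ)
import Data.Rational.Properties as ℚ
open import Data.Rational.Solver using (module +-*-Solver)
import Data.Rational.Unnormalised.Base as ℚᵘ
import Data.Rational.Unnormalised.Properties as ℚᵘ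
open import Data.Sum using (inj₁; inj₂; [_,_]′)
open import Data.Unit.Polymorphic.Base using (⊤; tt)
open import Data.Vec.Functional using (Vector; []; _∷_; tail)
open import Level using (Level; Lift; lift; lower; _⊔_)
open import Relation.Binary.Bundles using (Poset)
import Relation.Binary.Construct.On as On
open import Relation.Binary.PropositionalEquality as ≡ using (_≡_)
import Relation.Binary.Reasoning.PartialOrder as ≤-Reasoning
import Relation.Binary.Reasoning.Setoid as ≈-Reasoning
open import Relation.Nullary using (yes; no)
open import Relation.Nullary.Negation using (contradiction)
open 𝓓∞≤1

-- Algebraic compactness

-- The obstacle to continuity in the weights is normalisation: in r₀ x₀ + (1 - r₀) y the point y
-- carries the weights rᵢ / (1 - r₀), which divide by a real that may vanish, and 1 - r₀ decreases
-- as r₀ grows. Mixing both parts with the fixed weights ½ and ½ avoids this. The scalars used to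
-- cancel the ½ again are 1 - 1/(k+2), where 1/(k+2) arises from iterating c ↦ c / (1 + c) on ½.
--
-- Constructively a directed family of weights need not have a supremum, so continuity in the
-- weights concerns the suprema that exist. To exploit leastness, an upper bound for a single entry
-- or row has to be completed to one for the whole vector or matrix.
--
-- The fixpoints are constructed in `KS` itself and are not transported along the equivalence.

module _ {c ℓ₁ ℓ₂} (P : Poset c ℓ₁ ℓ₂) where
  open Poset P

  IsChainLub : ∀ ι → (ℕ → Carrier) → Carrier → Set _
  IsChainLub ι x = IsLub P {ι} {Lift ι ℕ} (λ i → x (lower i))

  module _ {x : ℕ → Carrier} (increasing : ∀ n → x n ≤ x (suc n)) where

    chain-mono : ∀ {m n} → m ℕ.≤′ n → x m ≤ x n
    chain-mono ℕ.≤′-refl     = refl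
    chain-mono (ℕ.≤′-step h) = trans (chain-mono h) (increasing _)

    chain-directed : ∀ {ι} → Directed P {ι} {Lift ι ℕ} (λ i → x (lower i))
    chain-directed .inhabitant = lift 0
    chain-directed .bound (lift i) (lift j) = lift (i ℕ.⊔ j)
      , chain-mono (ℕ.≤⇒≤′ (ℕ.m≤m⊔n i j)) , chain-mono (ℕ.≤⇒≤′ (ℕ.m≤n⊔m i j))

  lub-mono : ∀ {ι} {I : Set ι} {x y : I → Carrier} {s t} →
             (∀ i → x i ≤ y i) → IsLub P x s → IsLub P y t → s ≤ t
  lub-mono h l m = least l _ λ i → trans (h i) (upper m i)

  lub-unique : ∀ {ι} {I : Set ι} {x y : I → Carrier} {s t} →
               (∀ i → x i ≈ y i) → IsLub P x s → IsLub P y t → s ≈ t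
  lub-unique h l m = antisym (lub-mono (λ i → reflexive (h i)) l m)
                             (lub-mono (λ i → reflexive (Eq.sym (h i))) m l)

  IsLub-resp : ∀ {ι} {I : Set ι} {x y : I → Carrier} {s t} →
               (∀ i → x i ≈ y i) → s ≈ t → IsLub P x s → IsLub P y t
  IsLub-resp h e l .upper i    = trans (reflexive (Eq.sym (h i))) (trans (upper l i) (reflexive e))
  IsLub-resp h e l .least u u≥ = trans (reflexive (Eq.sym e)) (least l u λ i → trans (reflexive (h i)) (u≥ i))

  module Kleene {ι} (complete : DirectedComplete P ι) {⊥ : Carrier} (⊥-least : IsLeast P ⊥)
                {Φ : Carrier → Carrier} (Φ-scott : ScottContinuous P P ι Φ) where

    iterate : ℕ → Carrier
    iterate zero    = ⊥
    iterate (suc n) = Φ (iterate n)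

    iterate-increasing : ∀ n → iterate n ≤ iterate (suc n)
    iterate-increasing zero    = ⊥-least _
    iterate-increasing (suc n) = mono Φ-scott (iterate-increasing n)

    lfp : Carrier
    lfp = proj₁ (complete _ (chain-directed iterate-increasing))

    lfp-lub : IsChainLub ι iterate lfp
    lfp-lub = proj₂ (complete _ (chain-directed iterate-increasing))

    lfp-fixed : Φ lfp ≈ lfp
    lfp-fixed = antisym
      (least Φ-lub lfp λ (lift n) → upper lfp-lub (lift (suc n)))
      (least lfp-lub (Φ lfp) λ (lift n) → trans (iterate-increasing n) (upper Φ-lub (lift n)))
      where Φ-lub = pres-⨆ Φ-scott (chain-directed iterate-increasing) lfp-lub

    lfp-least : ∀ {x} → Φ x ≈ x → lfp ≤ x
    lfp-least {x} e = least lfp-lub x λ (lift n) → below-x n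
      where
      below-x : ∀ n → iterate n ≤ x
      below-x zero    = ⊥-least x
      below-x (suc n) = trans (mono Φ-scott (below-x n)) (reflexive e)

-- Initial algebras and final coalgebras of locally continuous functors

module _ {o h₁ h₂ h₃ ι} (𝓒 : Dcpo⊥!-Category o h₁ h₂ h₃ ι) where
  open Dcpo⊥!-Category 𝓒
  private
    module Hom {A B} = Poset (Hom A B)
    open Category category using (∘-cong)

  -- Continuity in each variable separately gives a double supremum over m and n; since both chains
  -- increase, the term at (m, n) lies below the diagonal term at `m ℕ.⊔ n`.
  ∘-chain-lub : ∀ {A B C} {g : ℕ → B ⇒ C} {f : ℕ → A ⇒ B} {g⁺ f⁺} →
                (∀ n → g n Hom.≤ g (suc n)) → (∀ n → f n Hom.≤ f (suc n)) →
                IsChainLub (Hom B C) ι g g⁺ → IsChainLub (Hom A B) ι f f⁺ →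
                IsChainLub (Hom A C) ι (λ n → g n ∘ f n) (g⁺ ∘ f⁺)
  ∘-chain-lub g↑ f↑ lg lf .upper i = ∘-mono (upper lg i) (upper lf i)
  ∘-chain-lub {A} {B} {C} {g} {f} {g⁺} {f⁺} g↑ f↑ lg lf .least u h =
    least (pres-⨆ (∘-scottˡ f⁺) (chain-directed (Hom B C) g↑) lg) u λ (lift m) →
    least (pres-⨆ (∘-scottʳ (g m)) (chain-directed (Hom A B) f↑) lf) u λ (lift n) →
      Hom.trans
        (∘-mono (chain-mono (Hom B C) g↑ (ℕ.≤⇒≤′ (ℕ.m≤m⊔n m n))) (chain-mono (Hom A B) f↑ (ℕ.≤⇒≤′ (ℕ.m≤n⊔m m n))))
        (h (lift (m ℕ.⊔ n)))

  module _ (F : Functor category category) (cont : LocallyContinuous 𝓒 F) where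
    open Functor F

    sandwich-scott : ∀ {A B C E} (g : F₀ C ⇒ E) (f : A ⇒ F₀ B) →
                     ScottContinuous (Hom B C) (Hom A E) ι (λ h → g ∘ F₁ h ∘ f)
    sandwich-scott g f = scott-∘ (∘-scottʳ g) (scott-∘ (∘-scottˡ f) cont)

    module MinimalInvariant {D} (fold : F₀ D ⇒ D) (unfold : D ⇒ F₀ D)
                            (isoˡ : unfold ∘ fold Hom.≈ id) (isoʳ : fold ∘ unfold Hom.≈ id) where

      module Approx = Kleene (Hom D D) hom-directedComplete ⊥ʰ-least (sandwich-scott fold unfold)

      module _ (minimal : Approx.lfp Hom.≈ id) where

        id-lub : IsChainLub (Hom D D) ι Approx.iterate id
        id-lub = IsLub-resp (Hom D D) (λ _ → Hom.Eq.refl) minimal Approx.lfp-lub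

        Approx-directed : Directed (Hom D D) {ι} {Lift ι ℕ} (λ i → Approx.iterate (lower i))
        Approx-directed = chain-directed (Hom D D) Approx.iterate-increasing

        -- The mediating map is the least solution of k = β ∘ F k ∘ unfold. Any solution k satisfies
        -- `K.iterate n ≈ k ∘ Approx.iterate n`: strictness of `k ∘_` gives the case 0, the algebra
        -- equation the step. Suprema on both sides, with `id` as supremum of the
        -- `Approx.iterate n`, turn this into `K.lfp ≈ k`.
        initial : IsInitialAlgebra F fold
        initial {B} β = K.lfp , commutes , unique
          where
          module K = Kleene (Hom D B) hom-directedComplete ⊥ʰ-least (sandwich-scott β unfold)

          commutes : K.lfp ∘ fold Hom.≈ β ∘ F₁ K.lfp
          commutes = begin
            K.lfp ∘ fold                       ≈⟨ ∘-cong K.lfp-fixed Hom.Eq.refl ⟨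
            (β ∘ F₁ K.lfp ∘ unfold) ∘ fold     ≈⟨ assoc ⟩
            β ∘ (F₁ K.lfp ∘ unfold) ∘ fold     ≈⟨ ∘-cong Hom.Eq.refl assoc ⟩
            β ∘ F₁ K.lfp ∘ unfold ∘ fold       ≈⟨ ∘-cong Hom.Eq.refl (∘-cong Hom.Eq.refl isoˡ) ⟩
            β ∘ F₁ K.lfp ∘ id                  ≈⟨ ∘-cong Hom.Eq.refl identityʳ ⟩
            β ∘ F₁ K.lfp                       ∎
            where open ≈-Reasoning (Category.hom-setoid category _ _)

          unique : ∀ {k} → k ∘ fold Hom.≈ β ∘ F₁ k → K.lfp Hom.≈ k
          unique {k} e = lub-unique (Hom D B) (λ (lift n) → approx n) K.lfp-lub
            (IsLub-resp (Hom D B) (λ _ → Hom.Eq.refl) identityʳ (pres-⨆ (∘-scottʳ k) Approx-directed id-lub))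
            where
            approx : ∀ n → K.iterate n Hom.≈ k ∘ Approx.iterate n
            approx zero    = Hom.antisym (⊥ʰ-least _) (∘-strictʳ k ⊥ʰ-least _)
            approx (suc n) = begin
              β ∘ F₁ (K.iterate n) ∘ unfold                 ≈⟨ ∘-cong Hom.Eq.refl (∘-cong (F-cong (approx n)) Hom.Eq.refl) ⟩
              β ∘ F₁ (k ∘ Approx.iterate n) ∘ unfold        ≈⟨ ∘-cong Hom.Eq.refl (∘-cong F-∘ Hom.Eq.refl) ⟩
              β ∘ (F₁ k ∘ F₁ (Approx.iterate n)) ∘ unfold   ≈⟨ ∘-cong Hom.Eq.refl assoc ⟩
              β ∘ F₁ k ∘ F₁ (Approx.iterate n) ∘ unfold     ≈⟨ assoc ⟨
              (β ∘ F₁ k) ∘ F₁ (Approx.iterate n) ∘ unfold   ≈⟨ ∘-cong e Hom.Eq.refl ⟨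
              (k ∘ fold) ∘ F₁ (Approx.iterate n) ∘ unfold   ≈⟨ assoc ⟩
              k ∘ fold ∘ F₁ (Approx.iterate n) ∘ unfold     ∎
              where open ≈-Reasoning (Category.hom-setoid category _ _)

        -- Dual to `initial`: the approximants of `id` are now composed on the left of k, so
        -- strictness and continuity of `_∘ k` are used.
        final : IsFinalCoalgebra F unfold
        final {B} β = K.lfp , commutes , unique
          where
          module K = Kleene (Hom B D) hom-directedComplete ⊥ʰ-least (sandwich-scott fold β)

          commutes : unfold ∘ K.lfp Hom.≈ F₁ K.lfp ∘ β
          commutes = begin
            unfold ∘ K.lfp                     ≈⟨ ∘-cong Hom.Eq.refl K.lfp-fixed ⟨
            unfold ∘ fold ∘ F₁ K.lfp ∘ β       ≈⟨ assoc ⟨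
            (unfold ∘ fold) ∘ F₁ K.lfp ∘ β     ≈⟨ ∘-cong isoˡ Hom.Eq.refl ⟩
            id ∘ F₁ K.lfp ∘ β                  ≈⟨ identityˡ ⟩
            F₁ K.lfp ∘ β                       ∎
            where open ≈-Reasoning (Category.hom-setoid category _ _)

          unique : ∀ {k} → unfold ∘ k Hom.≈ F₁ k ∘ β → K.lfp Hom.≈ k
          unique {k} e = lub-unique (Hom B D) (λ (lift n) → approx n) K.lfp-lub
            (IsLub-resp (Hom B D) (λ _ → Hom.Eq.refl) identityˡ (pres-⨆ (∘-scottˡ k) Approx-directed id-lub))
            where
            approx : ∀ n → K.iterate n Hom.≈ Approx.iterate n ∘ k
            approx zero    = Hom.antisym (⊥ʰ-least _) (∘-strictˡ k ⊥ʰ-least _)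
            approx (suc n) = begin
              fold ∘ F₁ (K.iterate n) ∘ β                   ≈⟨ ∘-cong Hom.Eq.refl (∘-cong (F-cong (approx n)) Hom.Eq.refl) ⟩
              fold ∘ F₁ (Approx.iterate n ∘ k) ∘ β          ≈⟨ ∘-cong Hom.Eq.refl (∘-cong F-∘ Hom.Eq.refl) ⟩
              fold ∘ (F₁ (Approx.iterate n) ∘ F₁ k) ∘ β     ≈⟨ ∘-cong Hom.Eq.refl assoc ⟩
              fold ∘ F₁ (Approx.iterate n) ∘ F₁ k ∘ β       ≈⟨ ∘-cong Hom.Eq.refl (∘-cong Hom.Eq.refl e) ⟨
              fold ∘ F₁ (Approx.iterate n) ∘ unfold ∘ k     ≈⟨ ∘-cong Hom.Eq.refl assoc ⟨
              fold ∘ (F₁ (Approx.iterate n) ∘ unfold) ∘ k   ≈⟨ assoc ⟨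
              (fold ∘ F₁ (Approx.iterate n) ∘ unfold) ∘ k   ∎
              where open ≈-Reasoning (Category.hom-setoid category _ _)

        canonicalFixpoint : CanonicalFixpoint F
        canonicalFixpoint = record
          { μF = D ; fold = fold ; unfold = unfold ; isoˡ = isoˡ ; isoʳ = isoʳ ; initial = initial ; final = final }

    module Tower {X₀} (X₀-zero : IsLeast (Hom X₀ X₀) id) where

      X : ℕ → Obj
      X zero    = X₀
      X (suc n) = F₀ (X n)

      -- An embedding for n ≤ m and the corresponding projection for n ≥ m.
      link : ∀ n m → X n ⇒ X m
      link zero    m       = ⊥ʰ
      link (suc n) zero    = ⊥ʰ
      link (suc n) (suc m) = F₁ (link n m)

      -- f factors through the identity of `X₀`, which is a least map, and composition is strict.
      -- Together with `from-X₀-least` this makes `X₀` a zero object.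
      to-X₀-least : ∀ {A} (f : A ⇒ X₀) → IsLeast (Hom A X₀) f
      to-X₀-least f g = Hom.trans (Hom.reflexive (Hom.Eq.sym identityˡ)) (∘-strictˡ f X₀-zero g)

      from-X₀-least : ∀ {A} (f : X₀ ⇒ A) → IsLeast (Hom X₀ A) f
      from-X₀-least f g = Hom.trans (Hom.reflexive (Hom.Eq.sym identityʳ)) (∘-strictʳ f X₀-zero g)

      link-refl : ∀ n → link n n Hom.≈ id
      link-refl zero    = Hom.antisym (⊥ʰ-least id) (X₀-zero ⊥ʰ)
      link-refl (suc n) = Hom.Eq.trans (F-cong (link-refl n)) F-id

      -- Only an inequality, since a detour through a small `X m` loses information. If an index is
      -- 0, the composite passes through or ends at the zero object and is least.
      link-∘ : ∀ n m k → link m k ∘ link n m Hom.≤ link n k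
      link-∘ zero    m       k       = ∘-strictʳ (link m k) ⊥ʰ-least _
      link-∘ (suc n) m       zero    = to-X₀-least _ _
      link-∘ (suc n) zero    (suc k) = ∘-strictˡ (link (suc n) zero) ⊥ʰ-least _
      link-∘ (suc n) (suc m) (suc k) = Hom.trans (Hom.reflexive (Hom.Eq.sym F-∘)) (mono cont (link-∘ n m k))

      -- A detour upwards from `X n` to `X (suc n)` loses nothing, so here the inequality opposite
      -- to `link-∘` holds.
      link-step : ∀ n m → link n m Hom.≤ link (suc n) m ∘ link n (suc n)
      link-step zero    m       = ⊥ʰ-least _
      link-step (suc n) zero    = ⊥ʰ-least _
      link-step (suc n) (suc m) = Hom.trans (mono cont (link-step n m)) (Hom.reflexive F-∘)

    -- The local description of a bilimit: instead of a universal property, the composites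
    -- `ε n ∘ π n` have supremum `id`. The inequalities for `link` make these composites increase.
    record Bilimit {X₀} (X₀-zero : IsLeast (Hom X₀ X₀) id) : Set (o ⊔ h₁ ⊔ h₂ ⊔ h₃ ⊔ Level.suc ι) where
      open Tower X₀-zero
      field
        D      : Obj
        ε      : ∀ n → X n ⇒ D
        π      : ∀ n → D ⇒ X n
        πε     : ∀ n → π n ∘ ε n Hom.≈ id
        ε-link : ∀ n → ε n Hom.≤ ε (suc n) ∘ link n (suc n)
        link-π : ∀ n → link n (suc n) ∘ π n Hom.≤ π (suc n)
        επ-lub : IsChainLub (Hom D D) ι (λ n → ε n ∘ π n) id

      επ-increasing : ∀ n → ε n ∘ π n Hom.≤ ε (suc n) ∘ π (suc n)
      επ-increasing n = Hom.trans (∘-mono (ε-link n) Hom.refl)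
        (Hom.trans (Hom.reflexive assoc) (∘-mono Hom.refl (link-π n)))

      -- As `X (suc n)` is `F₀ (X n)`, the maps `F₁ (ε n)` and `F₁ (π n)` relate the shifted tower
      -- to `F₀ D`. The comparison of `F₀ D` with `D` is approximated by passing through the common
      -- stage `X (suc n)`.
      foldₙ : ∀ n → F₀ D ⇒ D
      foldₙ n = ε (suc n) ∘ F₁ (π n)

      unfoldₙ : ∀ n → D ⇒ F₀ D
      unfoldₙ n = F₁ (ε n) ∘ π (suc n)

      foldₙ-increasing : ∀ n → foldₙ n Hom.≤ foldₙ (suc n)
      foldₙ-increasing n = Hom.trans (∘-mono (ε-link (suc n)) Hom.refl)
        (Hom.trans (Hom.reflexive assoc)
          (∘-mono Hom.refl (Hom.trans (Hom.reflexive (Hom.Eq.sym F-∘)) (mono cont (link-π n)))))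

      unfoldₙ-increasing : ∀ n → unfoldₙ n Hom.≤ unfoldₙ (suc n)
      unfoldₙ-increasing n = Hom.trans (∘-mono (Hom.trans (mono cont (ε-link n)) (Hom.reflexive F-∘)) Hom.refl)
        (Hom.trans (Hom.reflexive assoc) (∘-mono Hom.refl (link-π (suc n))))

      foldₙ-directed : Directed (Hom (F₀ D) D) {ι} {Lift ι ℕ} (λ i → foldₙ (lower i))
      foldₙ-directed = chain-directed (Hom (F₀ D) D) foldₙ-increasing

      unfoldₙ-directed : Directed (Hom D (F₀ D)) {ι} {Lift ι ℕ} (λ i → unfoldₙ (lower i))
      unfoldₙ-directed = chain-directed (Hom D (F₀ D)) unfoldₙ-increasing

      fold : F₀ D ⇒ D
      fold = proj₁ (hom-directedComplete _ foldₙ-directed)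

      fold-lub : IsChainLub (Hom (F₀ D) D) ι foldₙ fold
      fold-lub = proj₂ (hom-directedComplete _ foldₙ-directed)

      unfold : D ⇒ F₀ D
      unfold = proj₁ (hom-directedComplete _ unfoldₙ-directed)

      unfold-lub : IsChainLub (Hom D (F₀ D)) ι unfoldₙ unfold
      unfold-lub = proj₂ (hom-directedComplete _ unfoldₙ-directed)

      cancel : ∀ {A B C E} {g : B ⇒ E} {s : B ⇒ C} {r : C ⇒ B} {f : A ⇒ B} →
               r ∘ s Hom.≈ id → (g ∘ r) ∘ (s ∘ f) Hom.≈ g ∘ f
      cancel h = Hom.Eq.trans assoc (∘-cong Hom.Eq.refl
        (Hom.Eq.trans (Hom.Eq.sym assoc) (Hom.Eq.trans (∘-cong h Hom.Eq.refl) identityˡ)))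

      F-πε : ∀ n → F₁ (π n) ∘ F₁ (ε n) Hom.≈ id
      F-πε n = Hom.Eq.trans (Hom.Eq.sym F-∘) (Hom.Eq.trans (F-cong (πε n)) F-id)

      -- The composite of the n-th approximants collapses to `ε (suc n) ∘ π (suc n)`, so the chain
      -- is that of `επ-lub` without its first term, which does not affect the supremum.
      fold∘unfold : fold ∘ unfold Hom.≈ id
      fold∘unfold = Hom.antisym
        (least l id λ (lift n) → Hom.trans (Hom.reflexive (cancel (F-πε n))) (upper επ-lub (lift (suc n))))
        (least επ-lub _ λ (lift n) → Hom.trans (επ-increasing n)
          (Hom.trans (Hom.reflexive (Hom.Eq.sym (cancel (F-πε n)))) (upper l (lift n))))
        where
        l : IsChainLub (Hom D D) ι (λ n → foldₙ n ∘ unfoldₙ n) (fold ∘ unfold)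
        l = ∘-chain-lub foldₙ-increasing unfoldₙ-increasing fold-lub unfold-lub

      -- Here the n-th composite collapses to `F₁ (ε n ∘ π n)`, and local continuity of F identifies
      -- the supremum as `F₁ id`.
      unfold∘fold : unfold ∘ fold Hom.≈ id
      unfold∘fold = lub-unique (Hom (F₀ D) (F₀ D))
        (λ (lift n) → Hom.Eq.trans (cancel (πε (suc n))) (Hom.Eq.sym F-∘))
        (∘-chain-lub unfoldₙ-increasing foldₙ-increasing unfold-lub fold-lub)
        (IsLub-resp (Hom (F₀ D) (F₀ D)) (λ _ → Hom.Eq.refl) F-id
          (pres-⨆ cont (chain-directed (Hom D D) επ-increasing) επ-lub))

      module Invariant = MinimalInvariant fold unfold unfold∘fold fold∘unfold

      minimal : Invariant.Approx.lfp Hom.≈ id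
      minimal = Hom.antisym (lfp-least id-fixed) (least επ-lub lfp λ (lift n) → επ≤lfp n)
        where
        open Invariant.Approx

        id-fixed : fold ∘ F₁ id ∘ unfold Hom.≈ id
        id-fixed = Hom.Eq.trans (∘-cong Hom.Eq.refl (Hom.Eq.trans (∘-cong F-id Hom.Eq.refl) identityˡ)) fold∘unfold

        -- Induction on n. `ε 0` starts at the zero object and is least. For the step,
        -- `F₁ (π n) ∘ F₁ (ε n) ≈ id` allows a factor `F₁ (ε n ∘ π n)` to be inserted in the middle
        -- of `ε (suc n) ∘ π (suc n)`, where the induction hypothesis applies.
        επ≤lfp : ∀ n → ε n ∘ π n Hom.≤ lfp
        επ≤lfp zero    = ∘-strictˡ (π 0) (from-X₀-least (ε 0)) lfp
        επ≤lfp (suc n) = begin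
          ε (suc n) ∘ π (suc n)                         ≈⟨ cancel (F-πε n) ⟨
          foldₙ n ∘ unfoldₙ n                           ≈⟨ ∘-cong Hom.Eq.refl (cancel (F-πε n)) ⟨
          foldₙ n ∘ (F₁ (ε n) ∘ F₁ (π n)) ∘ unfoldₙ n   ≈⟨ ∘-cong Hom.Eq.refl (∘-cong F-∘ Hom.Eq.refl) ⟨
          foldₙ n ∘ F₁ (ε n ∘ π n) ∘ unfoldₙ n          ≤⟨ ∘-mono (upper fold-lub (lift n))
                                                             (∘-mono (mono cont (επ≤lfp n)) (upper unfold-lub (lift n))) ⟩
          fold ∘ F₁ lfp ∘ unfold                        ≈⟨ lfp-fixed ⟩
          lfp                                           ∎
          where open ≤-Reasoning (Hom D D)

      canonicalFixpoint : CanonicalFixpoint F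
      canonicalFixpoint = Invariant.canonicalFixpoint minimal

-- Bilimits of Kegelspitzen

module _ {i c ℓ₁ ℓ₂ ι} {A : Set i} (P : Poset c ℓ₁ ℓ₂) {I : Set ι} {x : I → A → Poset.Carrier P} where
  open Poset P

  directed-at : Directed (pointwise A P) x → ∀ a → Directed P (λ i → x i a)
  directed-at D a .inhabitant = inhabitant D
  directed-at D a .bound i j = let k , p , q = bound D i j in k , p a , q a

  lub-pointwise : ∀ {s} → (∀ a → IsLub P (λ i → x i a) (s a)) → IsLub (pointwise A P) x s
  lub-pointwise l .upper i a   = upper (l a) i
  lub-pointwise l .least u h a = least (l a) (u a) λ i → h i a

  -- Completeness supplies suprema at all points at once; together they form an upper bound of the
  -- family, and so s lies below them.
  lub-at : ∀ {s} → DirectedComplete P ι → Directed (pointwise A P) x → IsLub (pointwise A P) x s →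
           ∀ a → IsLub P (λ i → x i a) (s a)
  lub-at complete D l a .upper i   = upper l i a
  lub-at complete D l a .least u h =
    trans (least l (λ b → proj₁ (sup b)) (λ i b → upper (proj₂ (sup b)) i) a) (least (proj₂ (sup a)) u h)
    where
    sup : ∀ b → ∃ (IsLub P (λ i → x i b))
    sup b = complete _ (directed-at D b)

module _ {ℓ} (X : PointedConvexDcpo ℓ) where
  open PointedConvexDcpo X

  -- An instance of the continuity of `combine (mix p)`, with the second argument constantly ⊥. It
  -- serves both Kegelspitzen constructed below, `limit` and `model`.
  ·-scottʳ : ∀ p → ScottContinuous poset poset ℓ (p ·_)
  ·-scottʳ p .mono h = mono (combine-scott (mix p)) λ { zero → h ; (suc zero) → refl }
  ·-scottʳ p .pres-⨆ {I} {x} D l = pres-⨆ (combine-scott (mix p))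
    (record { inhabitant = inhabitant D
            ; bound = λ i j → let k , a , b = bound D i j in
                k , (λ { zero → a ; (suc zero) → refl }) , (λ { zero → b ; (suc zero) → refl }) })
    (lub-pointwise poset λ { zero → l
                           ; (suc zero) → record { upper = λ _ → refl ; least = λ u h → h (inhabitant D) } })

⋆ : ∀ {ℓ} → Kegelspitze ℓ
⋆ {ℓ} = record
  { pointedConvexDcpo = record
    { convexDcpo = record
      { dcpo = record { poset = 1-poset ; directedComplete = λ _ _ → tt , _ }
      ; convex = _
      ; combine-scott = _
      }
    ; ⊥-least = _
    }
  ; ·-scottˡ = _
  ; ·-scottʳ = _
  }
  where
  1-poset : Poset ℓ ℓ ℓ
  1-poset = record
    { Carrier = ⊤ ; _≈_ = λ _ _ → ⊤ ; _≤_ = λ _ _ → ⊤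
    ; isPartialOrder = _
    }

module _ {ℓ} (F : Functor (Dcpo⊥!-Category.category (KS ℓ)) (Dcpo⊥!-Category.category (KS ℓ)))
         (cont : LocallyContinuous (KS ℓ) F) where
  open Tower (KS ℓ) F cont {⋆} (λ _ _ → tt)
  open AffineScottMap
  private
    module X n = Kegelspitze (X n)

  -- The usual equations link (suc m) m (x (suc m)) ≈ x m of a limit follow, as link m (suc m) is an embedding.
  Compatible : (∀ n → X.Carrier n) → Set ℓ
  Compatible x = ∀ n m → X._≤_ m (fun (link n m) (x n)) (x m)

  Thread : Set ℓ
  Thread = ∃ Compatible

  thread-poset : Poset ℓ ℓ ℓ
  thread-poset = record
    { Carrier = Thread
    ; _≈_ = λ x y → ∀ n → X._≈_ n (proj₁ x n) (proj₁ y n)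
    ; _≤_ = λ x y → ∀ n → X._≤_ n (proj₁ x n) (proj₁ y n)
    ; isPartialOrder = record
      { isPreorder = record
        { isEquivalence = record
          { refl  = λ n → X.Eq.refl n
          ; sym   = λ h n → X.Eq.sym n (h n)
          ; trans = λ h k n → X.Eq.trans n (h n) (k n)
          }
        ; reflexive = λ h n → X.reflexive n (h n)
        ; trans     = λ h k n → X.trans n (h n) (k n)
        }
      ; antisym = λ h k n → X.antisym n (h n) (k n)
      }
    }

  module _ {ι} {I : Set ι} {x : I → Thread} where

    threads-at : Directed thread-poset x → ∀ n → Directed (X.poset n) (λ i → proj₁ (x i) n)
    threads-at D n .inhabitant = inhabitant D
    threads-at D n .bound i j = let k , p , q = bound D i j in k , p n , q n

    thread-lub : ∀ {s} → (∀ n → IsLub (X.poset n) (λ i → proj₁ (x i) n) (proj₁ s n)) → IsLub thread-poset x s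
    thread-lub l .upper i n   = upper (l n) i
    thread-lub l .least u h n = least (l n) (proj₁ u n) λ i → h i n

  module _ {I : Set ℓ} {x : I → Thread} (D : Directed thread-poset x) where

    thread-sup : ∀ n → ∃ (IsLub (X.poset n) (λ i → proj₁ (x i) n))
    thread-sup n = X.directedComplete n _ (threads-at D n)

    ⨆ᵗ : Thread
    ⨆ᵗ = (λ n → proj₁ (thread-sup n)) , λ n m →
      least (pres-⨆ (scott (link n m)) (threads-at D n) (proj₂ (thread-sup n))) _ λ i →
        X.trans m (proj₂ (x i) n m) (upper (proj₂ (thread-sup m)) i)

    thread-lub-at : ∀ {s} → IsLub thread-poset x s → ∀ n → IsLub (X.poset n) (λ i → proj₁ (x i) n) (proj₁ s n)
    thread-lub-at l n .upper i   = upper l i n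
    thread-lub-at l n .least u h = X.trans n (least l ⨆ᵗ (λ i m → upper (proj₂ (thread-sup m)) i) n)
                                             (least (proj₂ (thread-sup n)) u h)

  thread-complete : DirectedComplete thread-poset ℓ
  thread-complete x D = ⨆ᵗ D , thread-lub λ n → proj₂ (thread-sup D n)

  limit-pcd : PointedConvexDcpo ℓ
  limit-pcd = record
    { convexDcpo = record
      { dcpo = record
        { poset            = thread-poset
        ; directedComplete = thread-complete
        }
      ; convex = record
        { combine       = λ r x → (λ n → X.combine n r λ i → proj₁ (x i) n) , λ n m →
            X.trans m (X.reflexive m (affine (link n m) r _)) (mono (X.combine-scott m r) λ i → proj₂ (x i) n m)
        ; combine-cong  = λ h k n → X.combine-cong n h λ i → k i n
        ; combine-dirac = λ i x n → X.combine-dirac n i _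
        ; combine-⊛     = λ r s x n → X.combine-⊛ n r s _
        }
      ; combine-scott = λ r → record
        { mono   = λ h n → mono (X.combine-scott n r) λ i → h i n
        ; pres-⨆ = λ D l → thread-lub λ n → pres-⨆ (X.combine-scott n r)
            (record { inhabitant = inhabitant D
                    ; bound = λ i j → let k , p , q = bound D i j in k , (λ a → p a n) , (λ a → q a n) })
            (lub-pointwise (X.poset n) λ a → thread-lub-at (directed-at thread-poset D a)
              (lub-at thread-poset thread-complete D l a) n)
        }
      }
    ; ⊥       = (λ n → X.⊥ n) , λ n m → strict (link n m) (X.⊥-least n) (X.⊥ m)
    ; ⊥-least = λ x n → X.⊥-least n (proj₁ x n)
    }

  limit : Kegelspitze ℓ
  limit = record
    { pointedConvexDcpo = limit-pcd
    ; ·-scottˡ = λ x → record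
      { mono   = λ {p} {q} h n → X.trans n (X.reflexive n (·-at p x n))
          (X.trans n (mono (X.·-scottˡ n (proj₁ x n)) {p} {q} h) (X.reflexive n (X.Eq.sym n (·-at q x n))))
      ; pres-⨆ = λ {_} {p} {q} D l → thread-lub {s = q · x} λ n → IsLub-resp (X.poset n)
          (λ i → X.Eq.sym n (·-at (p i) x n)) (X.Eq.sym n (·-at q x n)) (pres-⨆ (X.·-scottˡ n (proj₁ x n)) {x = p} {s = q} D l)
      }
    ; ·-scottʳ = ·-scottʳ limit-pcd
    }
    where
    open PointedConvexDcpo limit-pcd using (_·_)

    -- Not definitional: taking n-th components of the vector `x ∷ ⊥ ∷ []` agrees with the vector of
    -- n-th components only after a case split on the index.
    ·-at : ∀ p x n → X._≈_ n (proj₁ (p · x) n) (X._·_ n p (proj₁ x n))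
    ·-at p x n = X.combine-cong n (λ _ → ℝ-Ring.refl) λ { zero → X.Eq.refl n ; (suc zero) → X.Eq.refl n }

  bilimit : Bilimit (KS ℓ) F cont {⋆} (λ _ _ → tt)
  bilimit = record
    { D      = limit
    ; ε      = λ n → record
      { fun    = λ x → (λ m → fun (link n m) x) , λ m k → link-∘ n m k x
      ; affine = λ r x m → affine (link n m) r x
      ; strict = λ h y m → strict (link n m) h (proj₁ y m)
      ; scott  = record
        { mono   = λ h m → mono (scott (link n m)) h
        ; pres-⨆ = λ D l → thread-lub λ m → pres-⨆ (scott (link n m)) D l
        }
      }
    ; π      = λ n → record
      { fun    = λ x → proj₁ x n
      ; affine = λ r x → X.Eq.refl n
      ; strict = λ h y → X.trans n (h (Kegelspitze.⊥ limit) n) (X.⊥-least n y)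
      ; scott  = record
        { mono   = λ h → h n
        ; pres-⨆ = λ D l → thread-lub-at D l n
        }
      }
    ; πε     = λ n x → link-refl n x
    ; ε-link = λ n x m → link-step n m x
    ; link-π = λ n x → proj₂ x n (suc n)
    ; επ-lub = record
      { upper = λ (lift n) x m → proj₂ x n m
      -- In component m the m-th term of the chain is already the identity.
      ; least = λ u h x m → X.trans m (X.reflexive m (X.Eq.sym m (link-refl m (proj₁ x m)))) (h (lift m) x m)
      }
    }

  fixpoint : CanonicalFixpoint F
  fixpoint = Bilimit.canonicalFixpoint bilimit

-- Subdistributions

⊓-<+ : ∀ a b c d {ε} → a ℚ.< c ℚ.+ ε → b ℚ.< d ℚ.+ ε → a ℚ.⊓ b ℚ.< c ℚ.⊓ d ℚ.+ ε
⊓-<+ a b c d {ε} h k with ℚ.⊓-sel c d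
... | inj₁ e = ≡.subst (λ t → a ℚ.⊓ b ℚ.< t ℚ.+ ε) (≡.sym e) (ℚ.≤-<-trans (ℚ.p⊓q≤p a b) h)
... | inj₂ e = ≡.subst (λ t → a ℚ.⊓ b ℚ.< t ℚ.+ ε) (≡.sym e) (ℚ.≤-<-trans (ℚ.p⊓q≤q a b) k)

⊓-within : ∀ a b c d {ε} → ℚ.∣ a ℚ.- c ∣ ℚ.< ε → ℚ.∣ b ℚ.- d ∣ ℚ.< ε → ℚ.∣ a ℚ.⊓ b ℚ.- c ℚ.⊓ d ∣ ℚ.< ε
⊓-within a b c d {ε} h k = Reals.<⇒∣∣< {a ℚ.⊓ b} {c ℚ.⊓ d}
  (⊓-<+ a b c d (Reals.∣∣<⇒< {a} {c} h) (Reals.∣∣<⇒< {b} {d} k))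
  (⊓-<+ c d a b (Reals.∣∣<⇒< {c} {a} (≡.subst (ℚ._< ε) (Reals.∣∣-flip a c) h))
                (Reals.∣∣<⇒< {d} {b} (≡.subst (ℚ._< ε) (Reals.∣∣-flip b d) k)))

infixl 7 _⊓ᵣ_

-- Minimum is 1-Lipschitz for the maximum norm, so ε serves for both sequences without halving.
_⊓ᵣ_ : ℝ → ℝ → ℝ
(x ⊓ᵣ y) .Reals.ℝ.seq n = Reals.seq x n ℚ.⊓ Reals.seq y n
(x ⊓ᵣ y) .Reals.ℝ.cauchy ε ε>0 with Reals.cauchy x ε ε>0 | Reals.cauchy y ε ε>0
... | M , p | N , q = M ℕ.⊔ N , λ m n hm hn →
  ⊓-within (Reals.seq x m) (Reals.seq y m) (Reals.seq x n) (Reals.seq y n)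
    (p m n (ℕ.m⊔n≤o⇒m≤o M N hm) (ℕ.m⊔n≤o⇒m≤o M N hn))
    (q m n (ℕ.m⊔n≤o⇒n≤o M N hm) (ℕ.m⊔n≤o⇒n≤o M N hn))

x⊓y≤x : ∀ x y → x ⊓ᵣ y ≤ᵣ x
x⊓y≤x x y = Reals.pointwise-≤ λ n → ℚ.p⊓q≤p (Reals.seq x n) (Reals.seq y n)

x⊓y≤y : ∀ x y → x ⊓ᵣ y ≤ᵣ y
x⊓y≤y x y = Reals.pointwise-≤ λ n → ℚ.p⊓q≤q (Reals.seq x n) (Reals.seq y n)

⊓-glb : ∀ {x y z} → z ≤ᵣ x → z ≤ᵣ y → z ≤ᵣ x ⊓ᵣ y
⊓-glb {x} {y} {z} h k .Reals._≤_.below ε ε>0 = Reals.ev-map₂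
  (λ n p q → ≡.subst (ℚ._< (Reals.seq (x ⊓ᵣ y) n ℚ.+ ε)) (ℚ.⊓-idem (Reals.seq z n)) (⊓-<+ (Reals.seq z n) (Reals.seq z n) (Reals.seq x n) (Reals.seq y n) p q))
  (Reals.below h ε ε>0) (Reals.below k ε ε>0)

subdistributions : ℕ → Poset _ _ _
subdistributions n = On.poset (pointwise (Fin n) Reals.≤-poset) weight

-- The proofs in the subdistributions below are abstract, so that conversion checking never unfolds them.

module _ {m n} (r : 𝓓∞≤1 m) (s : Fin m → 𝓓∞≤1 n) where
  abstract
    ⊛ᵈ-nonNeg : ∀ j → 0ᵣ ≤ᵣ (weight r ⊛ λ i → weight (s i)) j
    ⊛ᵈ-nonNeg = nonNeg (PosetCategory._∘_ 𝕃≤1 {n} {m} {1} (λ _ → r) s zero)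

    ⊛ᵈ-total≤1 : sum (weight r ⊛ λ i → weight (s i)) ≤ᵣ 1ᵣ
    ⊛ᵈ-total≤1 = total≤1 (PosetCategory._∘_ 𝕃≤1 {n} {m} {1} (λ _ → r) s zero)

  infixl 7 _⊛ᵈ_

  _⊛ᵈ_ : 𝓓∞≤1 n
  _⊛ᵈ_ = record { weight = weight r ⊛ λ i → weight (s i) ; nonNeg = ⊛ᵈ-nonNeg ; total≤1 = ⊛ᵈ-total≤1 }

module _ {n : ℕ} where
  abstract
    δᵈ-nonNeg : ∀ (i j : Fin n) → 0ᵣ ≤ᵣ δ i j
    δᵈ-nonNeg = δ-nonNeg

    δᵈ-total≤1 : ∀ (i : Fin n) → sum (δ i) ≤ᵣ 1ᵣ
    δᵈ-total≤1 i = Reals.≤-reflexive (sum-δ i)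

    0≤0 : (i : Fin n) → 0ᵣ ≤ᵣ 0ᵣ
    0≤0 i = Reals.≤-refl

    sum-0≤1 : sum {n} (λ _ → 0ᵣ) ≤ᵣ 1ᵣ
    sum-0≤1 = Reals.≤-trans (Reals.≤-reflexive (ℝ-Sum.sum-replicate-zero n)) (Reals.pointwise-≤ λ _ → ℚ.<⇒≤ Reals.0<1)

    simplex-total≤1 : (r : Simplex n) → sum (Simplex.weight r) ≤ᵣ 1ᵣ
    simplex-total≤1 r = Reals.≤-reflexive (Simplex.total r)

  δᵈ : Fin n → 𝓓∞≤1 n
  δᵈ i = record { weight = δ i ; nonNeg = δᵈ-nonNeg i ; total≤1 = δᵈ-total≤1 i }

  0ᵈ : 𝓓∞≤1 n
  0ᵈ = record { weight  = λ _ → 0ᵣ ; nonNeg  = 0≤0 ; total≤1 = sum-0≤1 }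

  simplexᵈ : Simplex n → 𝓓∞≤1 n
  simplexᵈ r = record { weight = Simplex.weight r ; nonNeg = Simplex.nonNeg r ; total≤1 = simplex-total≤1 r }

module _ (p : UnitInterval) where
  open UnitInterval p

  abstract
    [·]ᵈ-total≤1 : value +ᵣ 0ᵣ ≤ᵣ 1ᵣ
    [·]ᵈ-total≤1 = Reals.≤-trans (Reals.≤-reflexive (ℝ-Ring.+-identityʳ value)) ≤1

    mixᵈ-nonNeg : ∀ i → 0ᵣ ≤ᵣ Simplex.weight (mix p) i
    mixᵈ-nonNeg = Simplex.nonNeg (mix p)

    mixᵈ-total≤1 : sum (Simplex.weight (mix p)) ≤ᵣ 1ᵣ
    mixᵈ-total≤1 = Reals.≤-reflexive (Simplex.total (mix p))

  [_]ᵈ : 𝓓∞≤1 1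
  [_]ᵈ = record { weight = λ _ → value ; nonNeg = λ _ → 0≤ ; total≤1 = [·]ᵈ-total≤1 }

  mixᵈ : 𝓓∞≤1 2
  mixᵈ = record { weight = Simplex.weight (mix p) ; nonNeg = mixᵈ-nonNeg ; total≤1 = mixᵈ-total≤1 }

module _ {n} (r : 𝓓∞≤1 n) where
  abstract
    extend-nonNeg : ∀ i → 0ᵣ ≤ᵣ ((1ᵣ -ᵣ sum (weight r)) ∷ weight r) i
    extend-nonNeg zero    = Reals.x≤y⇒0≤y-x (total≤1 r)
    extend-nonNeg (suc i) = nonNeg r i

    extend-total : (1ᵣ -ᵣ sum (weight r)) +ᵣ sum (weight r) ≈ᵣ 1ᵣ
    extend-total = Reals.pointwise-≈ λ n →
      solve 1 (λ s → (con 1ℚ :- s) :+ s := con 1ℚ) ≡.refl (Reals.seq (sum (weight r)) n)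
      where open +-*-Solver using (solve; _:=_; con; _:+_; _:-_)

  -- The missing mass goes to index `zero`, where `subcombine` puts ⊥.
  extend : Simplex (suc n)
  extend = record { weight = (1ᵣ -ᵣ sum (weight r)) ∷ weight r ; nonNeg = extend-nonNeg ; total = extend-total }

-- The first weight is what the others leave of the total 1. Hence equations between subconvex
-- combinations never require a computation with the weight of ⊥.
Simplex-ext : ∀ {n} (r s : Simplex (suc n)) →
              (∀ i → Simplex.weight r (suc i) ≈ᵣ Simplex.weight s (suc i)) →
              ∀ i → Simplex.weight r i ≈ᵣ Simplex.weight s i
Simplex-ext r s h (suc i) = h i
Simplex-ext r s h zero    = ∙-cancelʳ (sum λ i → Simplex.weight s (suc i)) _ _
  (ℝ-Ring.trans (ℝ-Ring.+-congˡ (ℝ-Sum.sum-cong-≋ λ i → ℝ-Ring.sym (h i)))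
    (ℝ-Ring.trans (Simplex.total r) (ℝ-Ring.sym (Simplex.total s))))
  where open AbelianGroupProperties ℝ-Ring.+-abelianGroup using (∙-cancelʳ)

x≤x+y : ∀ x {y} → 0ᵣ ≤ᵣ y → x ≤ᵣ x +ᵣ y
x≤x+y x h = Reals.≤-trans (Reals.≤-reflexive (ℝ-Ring.sym (ℝ-Ring.+-identityʳ x))) (Reals.+-mono-≤ Reals.≤-refl h)

x≤y+x : ∀ x {y} → 0ᵣ ≤ᵣ y → x ≤ᵣ y +ᵣ x
x≤y+x x h = Reals.≤-trans (x≤x+y x h) (Reals.≤-reflexive (ℝ-Ring.+-comm x _))

module _ {n} (r : 𝓓∞≤1 (suc n)) where
  abstract
    head≤1 : weight r zero ≤ᵣ 1ᵣ
    head≤1 = Reals.≤-trans (x≤x+y _ (sum-nonNeg λ i → nonNeg r (suc i))) (total≤1 r)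

    tail-total≤1 : sum (tail (weight r)) ≤ᵣ 1ᵣ
    tail-total≤1 = Reals.≤-trans (x≤y+x _ (nonNeg r zero)) (total≤1 r)

  headᵈ : UnitInterval
  headᵈ = record { value = weight r zero ; 0≤ = nonNeg r zero ; ≤1 = head≤1 }

  tailᵈ : 𝓓∞≤1 n
  tailᵈ = record { weight = tail (weight r) ; nonNeg = λ i → nonNeg r (suc i) ; total≤1 = tail-total≤1 }

-- The pointwise minimum of s with any non-negative vector is again a subdistribution.
subdistribution-lub : ∀ {n ι} {I : Set ι} {r : I → 𝓓∞≤1 n} {s} → IsLub (subdistributions n) r s →
                      (v : Vector ℝ n) → (∀ i → 0ᵣ ≤ᵣ v i) → (∀ a i → weight (r a) i ≤ᵣ v i) →
                      ∀ i → weight s i ≤ᵣ v i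
subdistribution-lub {s = s} l v v≥0 h i = Reals.≤-trans
  (least l
    (record
      { weight  = λ j → weight s j ⊓ᵣ v j
      ; nonNeg  = λ j → ⊓-glb (nonNeg s j) (v≥0 j)
      ; total≤1 = Reals.≤-trans (sum-mono λ j → x⊓y≤x (weight s j) (v j)) (total≤1 s)
      })
    (λ a j → ⊓-glb (upper l a j) (h a j)) i)
  (x⊓y≤y (weight s i) (v i))

-- A bound for the heads is completed by the other entries of `s`. The resulting vector may have a
-- sum above 1, which `subdistribution-lub` permits; `tailᵈ-scott` proceeds likewise.
headᵈ-scott : ∀ {n ι} → ScottContinuous (subdistributions (suc n)) unitInterval ι headᵈ
headᵈ-scott .mono h = h zero
headᵈ-scott .pres-⨆ {I} {r} {s} D l .upper a = upper l a zero
headᵈ-scott .pres-⨆ {I} {r} {s} D l .least u h = subdistribution-lub {r = r} {s} l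
  (UnitInterval.value u ∷ λ i → weight s (suc i))
  (λ { zero → UnitInterval.0≤ u ; (suc i) → nonNeg s (suc i) })
  (λ { a zero → h a ; a (suc i) → upper l a (suc i) }) zero

tailᵈ-scott : ∀ {n ι} → ScottContinuous (subdistributions (suc n)) (subdistributions n) ι tailᵈ
tailᵈ-scott .mono h i = h (suc i)
tailᵈ-scott .pres-⨆ {I} {r} {s} D l .upper a i = upper l a (suc i)
tailᵈ-scott .pres-⨆ {I} {r} {s} D l .least u h i = subdistribution-lub {r = r} {s} l
  (weight s zero ∷ weight u)
  (λ { zero → nonNeg s zero ; (suc i) → nonNeg u i })
  (λ { a zero → upper l a zero ; a (suc i) → h a i }) (suc i)

module _ {c ℓ₁ ℓ₂ d m₁ m₂ i} {ι : Level} {P : Poset c ℓ₁ ℓ₂} {Q : Poset d m₁ m₂} {A : Set i} where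
  private
    module P = Poset P
    module Q = Poset Q

  scott-pointwise : {f : P.Carrier → A → Q.Carrier} → (∀ a → ScottContinuous P Q ι (λ x → f x a)) →
                    ScottContinuous P (pointwise A Q) ι f
  scott-pointwise F .mono h a      = F a .mono h
  scott-pointwise F .pres-⨆ D l = lub-pointwise Q λ a → F a .pres-⨆ D l

module _ {c ℓ₁ ℓ₂ d m₁ m₂} {ι : Level} {P : Poset c ℓ₁ ℓ₂} {Q : Poset d m₁ m₂} where
  private
    module P = Poset P
    module Q = Poset Q

  scott-const : (y : Q.Carrier) → ScottContinuous P Q ι (λ _ → y)
  scott-const y .mono _ = Q.refl
  scott-const y .pres-⨆ D l .upper _   = Q.refl
  scott-const y .pres-⨆ D l .least u h = h (inhabitant D)

  scott-resp : {f g : P.Carrier → Q.Carrier} → (∀ x → f x Q.≈ g x) →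
               ScottContinuous P Q ι f → ScottContinuous P Q ι g
  scott-resp e F .mono h = Q.trans (Q.reflexive (Q.Eq.sym (e _))) (Q.trans (F .mono h) (Q.reflexive (e _)))
  scott-resp e F .pres-⨆ D l = IsLub-resp Q (λ _ → e _) (e _) (F .pres-⨆ D l)

  -- A bound u on the values of f becomes the bound g u on those of g ∘ f, and the conclusion is
  -- reflected back. Applied below with halving as g.
  scott-reflect : ∀ {e n₁ n₂} {R : Poset e n₁ n₂} {f : P.Carrier → Q.Carrier} {g : Q.Carrier → Poset.Carrier R} →
                  (∀ {x y} → x Q.≤ y → Poset._≤_ R (g x) (g y)) → (∀ {x y} → Poset._≤_ R (g x) (g y) → x Q.≤ y) →
                  ScottContinuous P R ι (λ x → g (f x)) → ScottContinuous P Q ι f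
  scott-reflect g-mono g-refl G .mono h = g-refl (G .mono h)
  scott-reflect g-mono g-refl G .pres-⨆ D l .upper a = g-refl (upper (G .pres-⨆ D l) a)
  scott-reflect g-mono g-refl G .pres-⨆ D l .least u h = g-refl (least (G .pres-⨆ D l) _ λ a → g-mono (h a))

-- Subconvex combinations

module Subconvex {ℓ} (X : PointedConvexDcpo ℓ) where
  open PointedConvexDcpo X
  open ≈-Reasoning Eq.setoid

  combine-reindex : ∀ {m n} (r : Simplex m) (σ : Fin m → Fin n) (x : Vector Carrier n) →
                    combine r (λ i → x (σ i)) ≈ combine (r ⊛ˢ λ i → dirac (σ i)) x
  combine-reindex r σ x = Eq.trans
    (combine-cong (λ _ → ℝ-Ring.refl) λ i → Eq.sym (combine-dirac (σ i) x))
    (combine-⊛ r (λ i → dirac (σ i)) x)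

  subcombine : ∀ {n} → 𝓓∞≤1 n → Vector Carrier n → Carrier
  subcombine r x = combine (extend r) (⊥ ∷ x)

  subcombine-congˡ : ∀ {n} (r s : 𝓓∞≤1 n) {x : Vector Carrier n} →
                     (∀ i → weight r i ≈ᵣ weight s i) → subcombine r x ≈ subcombine s x
  subcombine-congˡ r s h = combine-cong (Simplex-ext (extend r) (extend s) h) λ _ → Eq.refl

  subcombine-scottʳ : ∀ {n} (r : 𝓓∞≤1 n) → ScottContinuous (pointwise (Fin n) poset) poset ℓ (subcombine r)
  subcombine-scottʳ r = scott-∘ (combine-scott (extend r))
    (scott-pointwise λ { zero → scott-const ⊥
                       ; (suc i) → record { mono = λ h → h i ; pres-⨆ = λ D l → lub-at poset directedComplete D l i } })

  subcombine-congʳ : ∀ {n} (r : 𝓓∞≤1 n) {x y : Vector Carrier n} →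
                     (∀ i → x i ≈ y i) → subcombine r x ≈ subcombine r y
  subcombine-congʳ r h = ScottContinuous.cong (subcombine-scottʳ r) h

  subcombine-δ : ∀ {n} (i : Fin n) (x : Vector Carrier n) → subcombine (δᵈ i) x ≈ x i
  subcombine-δ i x = Eq.trans
    (combine-cong (Simplex-ext (extend (δᵈ i)) (dirac (suc i)) λ _ → ℝ-Ring.refl) λ _ → Eq.refl)
    (combine-dirac (suc i) (⊥ ∷ x))

  subcombine-⊛ : ∀ {m n} (r : 𝓓∞≤1 m) (s : Fin m → 𝓓∞≤1 n) (x : Vector Carrier n) →
                 subcombine r (λ j → subcombine (s j) x) ≈ subcombine (r ⊛ᵈ s) x
  subcombine-⊛ {m} {n} r s x = begin
    combine (extend r) (⊥ ∷ λ j → subcombine (s j) x)   ≈⟨ combine-cong (λ _ → ℝ-Ring.refl) row ⟨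
    combine (extend r) (λ j → combine (rows j) (⊥ ∷ x)) ≈⟨ combine-⊛ (extend r) rows (⊥ ∷ x) ⟩
    combine (extend r ⊛ˢ rows) (⊥ ∷ x)                  ≈⟨ combine-cong weights (λ _ → Eq.refl) ⟩
    subcombine (r ⊛ᵈ s) x                               ∎
    where
    rows : Fin (suc m) → Simplex (suc n)
    -- The mass that `r` leaves to ⊥ stays on ⊥.
    rows zero    = dirac zero
    rows (suc j) = extend (s j)

    row : ∀ j → combine (rows j) (⊥ ∷ x) ≈ (⊥ ∷ λ j → subcombine (s j) x) j
    row zero    = combine-dirac zero (⊥ ∷ x)
    row (suc j) = Eq.refl

    weights = Simplex-ext (extend r ⊛ˢ rows) (extend (r ⊛ᵈ s)) λ i →
      ℝ-Ring.trans (ℝ-Ring.+-congʳ (ℝ-Ring.zeroʳ _)) (ℝ-Ring.+-identityˡ _)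

  subcombine-simplex : ∀ {n} (r : Simplex n) (x : Vector Carrier n) → subcombine (simplexᵈ r) x ≈ combine r x
  subcombine-simplex {n} r x = begin
    combine (extend (simplexᵈ r)) (⊥ ∷ x)           ≈⟨ combine-cong weights (λ _ → Eq.refl) ⟨
    combine (r ⊛ˢ λ i → dirac (suc i)) (⊥ ∷ x)      ≈⟨ combine-reindex r suc (⊥ ∷ x) ⟨
    combine r x                                     ∎
    where
    weights = Simplex-ext (r ⊛ˢ λ i → dirac (suc i)) (extend (simplexᵈ r)) λ i → sum-δʳ i (Simplex.weight r)

  subcombine-⊥ : ∀ {n} (r : 𝓓∞≤1 n) → subcombine r (λ _ → ⊥) ≈ ⊥
  subcombine-⊥ r = Eq.trans (combine-cong (λ _ → ℝ-Ring.refl) λ { zero → Eq.refl ; (suc i) → Eq.refl })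
                            (combine-const (extend r) ⊥)

  subcombine-0 : ∀ {n} (x : Vector Carrier n) → subcombine 0ᵈ x ≈ ⊥
  subcombine-0 {n} x = Eq.trans
    (combine-cong (Simplex-ext (extend (0ᵈ {n})) (dirac zero) λ _ → ℝ-Ring.refl) λ _ → Eq.refl)
    (combine-dirac zero (⊥ ∷ x))

  subcombine-const-≤ : ∀ {n} (r : 𝓓∞≤1 n) x → subcombine r (λ _ → x) ≤ x
  subcombine-const-≤ r x = trans
    (mono (combine-scott (extend r)) λ { zero → ⊥-least x ; (suc i) → refl })
    (reflexive (combine-const (extend r) x))

  ·-subcombine : ∀ p x → p · x ≈ subcombine [ p ]ᵈ (λ _ → x)
  ·-subcombine p x = begin
    combine (mix p) (x ∷ ⊥ ∷ [])                          ≈⟨ combine-cong (λ _ → ℝ-Ring.refl) (λ { zero → Eq.refl ; (suc zero) → Eq.refl }) ⟩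
    combine (mix p) (λ i → (⊥ ∷ x₁) (swap i))             ≈⟨ combine-reindex (mix p) swap (⊥ ∷ x₁) ⟩
    combine (mix p ⊛ˢ λ i → dirac (swap i)) (⊥ ∷ x₁)      ≈⟨ combine-cong weights (λ _ → Eq.refl) ⟩
    subcombine [ p ]ᵈ x₁                                  ∎
    where
    x₁ : Vector Carrier 1
    x₁ _ = x

    -- `mix p` lists ⊥ last, whereas `extend` lists it first.
    swap : Fin 2 → Fin 2
    swap zero       = suc zero
    swap (suc zero) = zero

    weight-1 : ∀ v → v *ᵣ 1ᵣ +ᵣ ((1ᵣ -ᵣ v) *ᵣ 0ᵣ +ᵣ 0ᵣ) ≈ᵣ v
    weight-1 v = ℝ-Ring.trans
      (ℝ-Ring.+-cong (ℝ-Ring.*-identityʳ v) (ℝ-Ring.trans (ℝ-Ring.+-identityʳ _) (ℝ-Ring.zeroʳ _)))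
      (ℝ-Ring.+-identityʳ v)

    weights = Simplex-ext (mix p ⊛ˢ λ i → dirac (swap i)) (extend [ p ]ᵈ) λ { zero → weight-1 (UnitInterval.value p) }

-- Continuity of subconvex combinations in the weights

-- recip k is 1 / (k + 2).
recip : ℕ → ℚ
recip k = mkℚ (+ 1) (suc k) (Coprimality.1-coprimeTo (suc (suc k)))

recip≥0 : ∀ k → 0ℚ ℚ.≤ recip k
recip≥0 k = ℚ.nonNegative⁻¹ (recip k)

recip-anti : ∀ k → recip (suc k) ℚ.≤ recip k
recip-anti k = ℚ.*≤* (ℤ.+≤+ (ℕ.+-monoˡ-≤ 0 (ℕ.n≤1+n (suc (suc k)))))

recip≤½ : ∀ k → recip k ℚ.≤ ½
recip≤½ k = ℚ.*≤* (ℤ.+≤+ (s≤s (s≤s z≤n)))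

-- The recursion c′ = c / (1 + c), freed of division, in the form that `scale-step` takes as a
-- hypothesis.
recip-step : ∀ k → recip (suc k) ℚ.* (1ℚ ℚ.+ recip k) ≡ recip k
recip-step k = ℚ.toℚᵘ-injective (ℚᵘ.≃-trans (ℚ.toℚᵘ-homo-* (recip (suc k)) (1ℚ ℚ.+ recip k))
  (ℚᵘ.≃-trans (ℚᵘ.*-cong (ℚᵘ.≃-refl {ℚ.toℚᵘ (recip (suc k))}) (ℚ.toℚᵘ-homo-+ 1ℚ (recip k)))
    (ℚᵘ.*≡* (≡.cong +_ (solve 1 (λ k → (con 1 :* (con 1 :* (con 2 :+ k) :+ con 1)) :* (con 2 :+ k)
                                   := con 1 :* ((con 3 :+ k) :* (con 1 :* (con 2 :+ k)))) ≡.refl k)))))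
  where open ℕ-Solver.+-*-Solver

recip-archimedean : ∀ {ε} → 0ℚ ℚ.< ε → ∃ λ k → recip k ℚ.< ε
-- The denominator of `recip d-1` exceeds that of ε by one, so the inequality is strict even for
-- numerator 1.
recip-archimedean {mkℚ +[1+ n ] d-1 _} _ = d-1 , ℚ.*<* (ℤ.+<+ (ℕ.≤-trans
  (ℕ.≤-reflexive (≡.cong suc (ℕ.+-identityʳ (suc d-1)))) (ℕ.m≤m+n (suc (suc d-1)) (n ℕ.* suc (suc d-1)))))
recip-archimedean {mkℚ (+ 0) d-1 _} (ℚ.*<* (ℤ.+<+ ()))
recip-archimedean {mkℚ -[1+ n ] d-1 _} (ℚ.*<* ())

abstract
  fromℚ-mono : ∀ {p q} → p ℚ.≤ q → Reals.fromℚ p ≤ᵣ Reals.fromℚ q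
  fromℚ-mono h = Reals.pointwise-≤ λ _ → h

  1-p≤1 : ∀ {p} → 0ℚ ℚ.≤ p → 1ℚ ℚ.- p ℚ.≤ 1ℚ
  1-p≤1 {p} h = ≡.subst (1ℚ ℚ.- p ℚ.≤_) (ℚ.+-identityʳ 1ℚ) (ℚ.+-monoʳ-≤ 1ℚ (ℚ.neg-antimono-≤ h))

  0≤1-p : ∀ {p} → p ℚ.≤ 1ℚ → 0ℚ ℚ.≤ 1ℚ ℚ.- p
  0≤1-p {p} h = ≡.subst (ℚ._≤ 1ℚ ℚ.- p) (ℚ.+-inverseʳ p) (ℚ.+-monoˡ-≤ (ℚ.- p) h)

rational : ∀ q → 0ℚ ℚ.≤ q → q ℚ.≤ 1ℚ → UnitInterval
rational q 0≤q q≤1 = record { value = Reals.fromℚ q ; 0≤ = fromℚ-mono 0≤q ; ≤1 = fromℚ-mono q≤1 }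

1- : ∀ q → 0ℚ ℚ.≤ q → q ℚ.≤ 1ℚ → UnitInterval
1- q 0≤q q≤1 = rational (1ℚ ℚ.- q) (0≤1-p q≤1) (1-p≤1 0≤q)

½≤1 : ½ ℚ.≤ 1ℚ
½≤1 = ℚ.*≤* (ℤ.+≤+ (s≤s z≤n))

approach : ℕ → UnitInterval
approach k = 1- (recip k) (recip≥0 k) (ℚ.≤-trans (recip≤½ k) ½≤1)

unit : UnitInterval
unit = rational 1ℚ (ℚ.<⇒≤ Reals.0<1) ℚ.≤-refl

approach-increasing : ∀ k → Poset._≤_ unitInterval (approach k) (approach (suc k))
approach-increasing k = Reals.pointwise-≤ λ _ → ℚ.+-monoʳ-≤ 1ℚ (ℚ.neg-antimono-≤ (recip-anti k))

approach-lub : ∀ {ι} → IsChainLub unitInterval ι approach unit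
approach-lub .upper (lift k) = UnitInterval.≤1 (approach k)
approach-lub .least u h .Reals._≤_.below ε ε>0 =
  -- One half of ε absorbs `recip k`, the other the slack in the comparison with `u`.
  let k , small = recip-archimedean (Reals.half>0 ε>0)
  in Reals.ev-map (λ n p → close (recip k) (Reals.seq (UnitInterval.value u) n) small p)
       (Reals.below (h (lift k)) (½ ℚ.* ε) (Reals.half>0 ε>0))
  where
  open +-*-Solver using (solve; _:=_; con; _:+_; _:-_; _:*_)
  close : ∀ c v → c ℚ.< ½ ℚ.* ε → 1ℚ ℚ.- c ℚ.< v ℚ.+ ½ ℚ.* ε → 1ℚ ℚ.< v ℚ.+ ε
  close c v h k = ≡.subst₂ ℚ._<_ (solve 1 (λ c → (con 1ℚ :- c) :+ c := con 1ℚ) ≡.refl c)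
    (≡.trans (ℚ.+-assoc v (½ ℚ.* ε) (½ ℚ.* ε)) (≡.cong (v ℚ.+_) (Reals.half+half ε))) (ℚ.+-mono-< k h)

half : UnitInterval
half = rational ½ (ℚ.*≤* (ℤ.+≤+ z≤n)) ½≤1

module Scaling {ℓ} (X : PointedConvexDcpo ℓ) where
  open PointedConvexDcpo X
  open Subconvex X

  scale : UnitInterval → Carrier → Carrier
  scale p x = subcombine [ p ]ᵈ (λ _ → x)

  mixture : UnitInterval → Carrier → Carrier → Carrier
  mixture p x y = subcombine (mixᵈ p) (x ∷ y ∷ [])

  mixture-monoʳ : ∀ p x {y z} → y ≤ z → mixture p x y ≤ mixture p x z
  mixture-monoʳ p x h = mono (subcombine-scottʳ (mixᵈ p)) λ { zero → refl ; (suc zero) → h }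

  module _ {n} {v : Vector Carrier n} where

    -- Nested combinations are flattened to combinations of one vector `v`. Equations between them
    -- then become equations between weights, which the ring solver settles.
    subcombine-rows : ∀ {m} (r : 𝓓∞≤1 m) (s : Fin m → 𝓓∞≤1 n) {x : Vector Carrier m} →
                      (∀ j → x j ≈ subcombine (s j) v) → subcombine r x ≈ subcombine (r ⊛ᵈ s) v
    subcombine-rows r s h = Eq.trans (subcombine-congʳ r h) (subcombine-⊛ r s v)

    scale-row : ∀ p {x} (d : 𝓓∞≤1 n) → x ≈ subcombine d v → scale p x ≈ subcombine ([ p ]ᵈ ⊛ᵈ λ _ → d) v
    scale-row p d h = subcombine-rows [ p ]ᵈ (λ _ → d) λ _ → h

    mixture-row : ∀ p {x y} (d e : 𝓓∞≤1 n) → x ≈ subcombine d v → y ≈ subcombine e v →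
                  mixture p x y ≈ subcombine (mixᵈ p ⊛ᵈ (d ∷ e ∷ [])) v
    mixture-row p d e h k = subcombine-rows (mixᵈ p) (d ∷ e ∷ []) λ { zero → h ; (suc zero) → k }

    -- With c′ = c / (1 + c), first weight c′ is moved from x to y using ½ x ≤ ½ y, then the remaining
    -- 1 - 2c′ using (1 - c) x ≤ (1 - c) y; the weight c′ of ⊥ makes room for both.
    module _ {x y} (d e : 𝓓∞≤1 n) (x≈ : x ≈ subcombine d v) (y≈ : y ≈ subcombine e v)
             (c c′ : ℚ) (0≤c : 0ℚ ℚ.≤ c) (c≤1 : c ℚ.≤ 1ℚ) (0≤c′ : 0ℚ ℚ.≤ c′) (c′≤½ : c′ ℚ.≤ ½)
             (c′[1+c]≡c : c′ ℚ.* (1ℚ ℚ.+ c) ≡ c) where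
      private
        0≤2c′ : 0ℚ ℚ.≤ c′ ℚ.+ c′
        0≤2c′ = ℚ.+-mono-≤ 0≤c′ 0≤c′
        p  = 1- c 0≤c c≤1
        p′ = 1- c′ 0≤c′ (ℚ.≤-trans c′≤½ ½≤1)
        u  = 1- (c′ ℚ.+ c′) 0≤2c′ (ℚ.+-mono-≤ c′≤½ c′≤½)
        w  = rational c′ 0≤c′ (ℚ.≤-trans c′≤½ ½≤1)

        open +-*-Solver using (solve; _:=_; con; _:+_; _:-_; _:*_)

        weights₁ : ∀ a → (1ℚ ℚ.- c′) ℚ.* a ℚ.+ 0ℚ ≡
          (1ℚ ℚ.- (c′ ℚ.+ c′)) ℚ.* a ℚ.+ ((1ℚ ℚ.- (1ℚ ℚ.- (c′ ℚ.+ c′))) ℚ.* (½ ℚ.* a ℚ.+ 0ℚ) ℚ.+ 0ℚ)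
        weights₁ = solve 2 (λ c a → (con 1ℚ :- c) :* a :+ con 0ℚ :=
          (con 1ℚ :- (c :+ c)) :* a :+ ((con 1ℚ :- (con 1ℚ :- (c :+ c))) :* (con ½ :* a :+ con 0ℚ) :+ con 0ℚ)) ≡.refl c′

        1-2c′ : (1ℚ ℚ.- c′) ℚ.* (1ℚ ℚ.- c) ≡ 1ℚ ℚ.- (c′ ℚ.+ c′)
        1-2c′ = ≡.trans
          (solve 2 (λ c c′ → (con 1ℚ :- c′) :* (con 1ℚ :- c) := ((con 1ℚ :- c′) :+ c′ :* c) :- c) ≡.refl c c′)
          -- Writing the isolated c as c′ (1 + c) makes the product c′ c cancel.
          (≡.trans (≡.cong (λ t → ((1ℚ ℚ.- c′) ℚ.+ c′ ℚ.* c) ℚ.- t) (≡.sym c′[1+c]≡c))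
            (solve 2 (λ c c′ → ((con 1ℚ :- c′) :+ c′ :* c) :- c′ :* (con 1ℚ :+ c) := con 1ℚ :- (c′ :+ c′)) ≡.refl c c′))

        weights₂ : ∀ a b →
          (1ℚ ℚ.- (c′ ℚ.+ c′)) ℚ.* a ℚ.+ ((1ℚ ℚ.- (1ℚ ℚ.- (c′ ℚ.+ c′))) ℚ.* (½ ℚ.* b ℚ.+ 0ℚ) ℚ.+ 0ℚ) ≡
          c′ ℚ.* b ℚ.+ ((1ℚ ℚ.- c′) ℚ.* ((1ℚ ℚ.- c) ℚ.* a ℚ.+ 0ℚ) ℚ.+ 0ℚ)
        weights₂ a b = ≡.trans
          (solve 3 (λ c a b → (con 1ℚ :- (c :+ c)) :* a :+
              ((con 1ℚ :- (con 1ℚ :- (c :+ c))) :* (con ½ :* b :+ con 0ℚ) :+ con 0ℚ) :=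
            c :* b :+ (con 1ℚ :- (c :+ c)) :* a) ≡.refl c′ a b)
          (≡.trans (≡.cong (λ t → c′ ℚ.* b ℚ.+ t ℚ.* a) (≡.sym 1-2c′))
            (solve 4 (λ c c′ a b → c′ :* b :+ ((con 1ℚ :- c′) :* (con 1ℚ :- c)) :* a :=
              c′ :* b :+ ((con 1ℚ :- c′) :* ((con 1ℚ :- c) :* a :+ con 0ℚ) :+ con 0ℚ)) ≡.refl c c′ a b))

        -- For equal points the two preceding identities meet: moving weight between them keeps the
        -- total factor 1 - c′.
        weights₃ : ∀ b → c′ ℚ.* b ℚ.+ ((1ℚ ℚ.- c′) ℚ.* ((1ℚ ℚ.- c) ℚ.* b ℚ.+ 0ℚ) ℚ.+ 0ℚ) ≡ (1ℚ ℚ.- c′) ℚ.* b ℚ.+ 0ℚ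
        weights₃ b = ≡.trans (≡.sym (weights₂ b b)) (≡.sym (weights₁ b))

      scale-step : scale half x ≤ scale half y → scale p x ≤ scale p y → scale p′ x ≤ scale p′ y
      scale-step H P = begin
        scale p′ x                   ≈⟨ Eq.trans (scale-row p′ d x≈) (Eq.trans
                                          (subcombine-congˡ ([ p′ ]ᵈ ⊛ᵈ λ _ → d) (mixᵈ u ⊛ᵈ (d ∷ ([ half ]ᵈ ⊛ᵈ λ _ → d) ∷ []))
                                            λ i → Reals.pointwise-≈ λ k → weights₁ (Reals.seq (weight d i) k))
                                          (Eq.sym (mixture-row u d ([ half ]ᵈ ⊛ᵈ λ _ → d) x≈ (scale-row half d x≈)))) ⟩
        mixture u x (scale half x)   ≤⟨ mixture-monoʳ u x H ⟩
        mixture u x (scale half y)   ≈⟨ Eq.trans (mixture-row u d ([ half ]ᵈ ⊛ᵈ λ _ → e) x≈ (scale-row half e y≈)) (Eq.trans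
                                          (subcombine-congˡ (mixᵈ u ⊛ᵈ (d ∷ ([ half ]ᵈ ⊛ᵈ λ _ → e) ∷ [])) (mixᵈ w ⊛ᵈ (e ∷ ([ p ]ᵈ ⊛ᵈ λ _ → d) ∷ []))
                                            λ i → Reals.pointwise-≈ λ k → weights₂ (Reals.seq (weight d i) k) (Reals.seq (weight e i) k))
                                          (Eq.sym (mixture-row w e ([ p ]ᵈ ⊛ᵈ λ _ → d) y≈ (scale-row p d x≈)))) ⟩
        mixture w y (scale p x)      ≤⟨ mixture-monoʳ w y P ⟩
        mixture w y (scale p y)      ≈⟨ Eq.trans (mixture-row w e ([ p ]ᵈ ⊛ᵈ λ _ → e) y≈ (scale-row p e y≈)) (Eq.trans
                                          (subcombine-congˡ (mixᵈ w ⊛ᵈ (e ∷ ([ p ]ᵈ ⊛ᵈ λ _ → e) ∷ [])) ([ p′ ]ᵈ ⊛ᵈ λ _ → e)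
                                            λ i → Reals.pointwise-≈ λ k → weights₃ (Reals.seq (weight e i) k))
                                          (Eq.sym (scale-row p′ e y≈))) ⟩
        scale p′ y                   ∎
        where open ≤-Reasoning poset

module Weights {ℓ} (K : Kegelspitze ℓ) where
  open Kegelspitze K
  open Subconvex pointedConvexDcpo
  open Scaling pointedConvexDcpo

  scale-scottˡ : ∀ x → ScottContinuous unitInterval poset ℓ (λ p → scale p x)
  scale-scottˡ x = scott-resp (λ p → ·-subcombine p x) (·-scottˡ x)

  scale-unit : ∀ x → scale unit x ≈ x
  scale-unit x = Eq.trans (subcombine-congˡ [ unit ]ᵈ (δᵈ zero) λ { zero → ℝ-Ring.refl }) (subcombine-δ zero λ _ → x)

  half-reflects-≤ : ∀ {x y} → scale half x ≤ scale half y → x ≤ y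
  half-reflects-≤ {x} {y} h = trans (reflexive (Eq.sym (scale-unit x)))
    (least (pres-⨆ (scale-scottˡ x) (chain-directed unitInterval approach-increasing) approach-lub) y
      λ (lift k) → trans (approach-≤ k) (subcombine-const-≤ [ approach k ]ᵈ y))
    where
    xy : Vector Carrier 2
    xy = x ∷ y ∷ []

    approach-≤ : ∀ k → scale (approach k) x ≤ scale (approach k) y
    -- The scalar 1 - `recip 0` is ½, so the hypothesis itself starts the induction.
    approach-≤ zero    = trans (reflexive (half≈ x)) (trans h (reflexive (Eq.sym (half≈ y))))
      where
      half≈ : ∀ z → scale (approach 0) z ≈ scale half z
      half≈ z = subcombine-congˡ [ approach 0 ]ᵈ [ half ]ᵈ λ _ → Reals.pointwise-≈ λ _ → ≡.refl
    approach-≤ (suc k) = scale-step {v = xy} (δᵈ zero) (δᵈ (suc zero))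
      (Eq.sym (subcombine-δ zero xy)) (Eq.sym (subcombine-δ (suc zero) xy))
      (recip k) (recip (suc k)) (recip≥0 k) (ℚ.≤-trans (recip≤½ k) ½≤1) (recip≥0 (suc k)) (recip≤½ (suc k))
      (recip-step k) h (approach-≤ k)

  -- ½ (Σ rᵢ xᵢ) = ½ (r₀ x₀) + ½ (Σ rᵢ₊₁ xᵢ₊₁), and halving reflects the order.
  subcombine-scottˡ : ∀ {n} (x : Vector Carrier n) → ScottContinuous (subdistributions n) poset ℓ (λ r → subcombine r x)
  subcombine-scottˡ {zero} x = scott-resp (λ r → subcombine-congˡ 0ᵈ r λ ()) (scott-const (subcombine 0ᵈ x))
  subcombine-scottˡ {suc n} x = scott-reflect
    (λ h → mono (subcombine-scottʳ [ half ]ᵈ) λ _ → h) half-reflects-≤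
    (scott-resp split (scott-∘ (subcombine-scottʳ (mixᵈ half))
      (scott-pointwise λ { zero → scott-∘ (scale-scottˡ (x zero)) headᵈ-scott
                         ; (suc zero) → scott-∘ (subcombine-scottˡ (λ i → x (suc i))) tailᵈ-scott })))
    where
    open +-*-Solver using (solve; _:=_; con; _:+_; _:-_; _:*_)

    head-weight : ∀ a → ½ ℚ.* (a ℚ.* 1ℚ ℚ.+ 0ℚ) ℚ.+ ((1ℚ ℚ.- ½) ℚ.* 0ℚ ℚ.+ 0ℚ) ≡ ½ ℚ.* a ℚ.+ 0ℚ
    head-weight = solve 1 (λ a → con ½ :* (a :* con 1ℚ :+ con 0ℚ) :+ ((con 1ℚ :- con ½) :* con 0ℚ :+ con 0ℚ) :=
      con ½ :* a :+ con 0ℚ) ≡.refl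

    tail-weight : ∀ a b → ½ ℚ.* (a ℚ.* 0ℚ ℚ.+ 0ℚ) ℚ.+ ((1ℚ ℚ.- ½) ℚ.* b ℚ.+ 0ℚ) ≡ ½ ℚ.* b ℚ.+ 0ℚ
    tail-weight = solve 2 (λ a b → con ½ :* (a :* con 0ℚ :+ con 0ℚ) :+ ((con 1ℚ :- con ½) :* b :+ con 0ℚ) :=
      con ½ :* b :+ con 0ℚ) ≡.refl

    sum-zeroʳ : ∀ {n} (a : Vector ℝ n) → ∑[ j < n ] (a j *ᵣ 0ᵣ) ≈ᵣ 0ᵣ
    sum-zeroʳ a = ℝ-Ring.trans (ℝ-Ring.sym (ℝ-Sum.*-distribʳ-sum 0ᵣ a)) (ℝ-Ring.zeroʳ (sum a))

    parts : 𝓓∞≤1 (suc n) → Fin 2 → Carrier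
    parts r zero       = scale (headᵈ r) (x zero)
    parts r (suc zero) = subcombine (tailᵈ r) (λ i → x (suc i))

    module _ (r : 𝓓∞≤1 (suc n)) where
      rows : Fin 2 → 𝓓∞≤1 (suc n)
      rows zero       = [ headᵈ r ]ᵈ ⊛ᵈ λ _ → δᵈ zero
      rows (suc zero) = tailᵈ r ⊛ᵈ λ i → δᵈ (suc i)

      parts-rows : ∀ j → parts r j ≈ subcombine (rows j) x
      parts-rows zero       = subcombine-rows [ headᵈ r ]ᵈ (λ _ → δᵈ zero) λ _ → Eq.sym (subcombine-δ zero x)
      parts-rows (suc zero) = subcombine-rows (tailᵈ r) (λ i → δᵈ (suc i)) λ i → Eq.sym (subcombine-δ (suc i) x)

      weights : ∀ i → weight (mixᵈ half ⊛ᵈ rows) i ≈ᵣ weight ([ half ]ᵈ ⊛ᵈ λ _ → r) i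
      weights zero = ℝ-Ring.trans
        (ℝ-Ring.+-congˡ (ℝ-Ring.+-congʳ (ℝ-Ring.*-congˡ {1ᵣ -ᵣ UnitInterval.value half} (sum-zeroʳ (tail (weight r))))))
        (Reals.pointwise-≈ λ n → head-weight (Reals.seq (weight r zero) n))
      weights (suc i) = ℝ-Ring.trans
        (ℝ-Ring.+-congˡ (ℝ-Ring.+-congʳ (ℝ-Ring.*-congˡ {1ᵣ -ᵣ UnitInterval.value half} (sum-δʳ i (tail (weight r))))))
        (Reals.pointwise-≈ λ n → tail-weight (Reals.seq (weight r zero) n) (Reals.seq (weight r (suc i)) n))

      split : subcombine (mixᵈ half) (parts r) ≈ scale half (subcombine r x)
      split = begin
        subcombine (mixᵈ half) (parts r)            ≈⟨ subcombine-rows (mixᵈ half) rows parts-rows ⟩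
        subcombine (mixᵈ half ⊛ᵈ rows) x            ≈⟨ subcombine-congˡ (mixᵈ half ⊛ᵈ rows) ([ half ]ᵈ ⊛ᵈ λ _ → r) weights ⟩
        subcombine ([ half ]ᵈ ⊛ᵈ λ _ → r) x         ≈⟨ subcombine-⊛ [ half ]ᵈ (λ _ → r) x ⟨
        scale half (subcombine r x)                 ∎
        where open ≈-Reasoning Eq.setoid

-- Product-preserving functors on 𝕃≤1

private
  module 𝕃 = PosetCategory 𝕃≤1

𝕃-category : Category _ _ _
𝕃-category = 𝕃.category

0ᵃ : ∀ {n m} → n 𝕃.⇒ m
0ᵃ _ = 0ᵈ

0ᵃ-least : ∀ {n m} → IsLeast (𝕃.Hom n m) 0ᵃ
0ᵃ-least f k i = nonNeg (f k) i

arrow : ∀ {n} → 𝓓∞≤1 n → n 𝕃.⇒ 1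
arrow r _ = r

proj : ∀ {n} → Fin n → n 𝕃.⇒ 1
proj i = arrow (δᵈ i)

p₁ : ∀ A B → (A ℕ.+ B) 𝕃.⇒ A
p₁ A B i = δᵈ (i ↑ˡ B)

p₂ : ∀ A B → (A ℕ.+ B) 𝕃.⇒ B
p₂ A B i = δᵈ (A ↑ʳ i)

select : ∀ {a} {X : Set a} A {B} → (Fin A → X) → (Fin B → X) → Fin (A ℕ.+ B) → X
select A f g j = [ f , g ]′ (splitAt A j)

module _ {c ℓ} {X : Set c} (_≈_ : X → X → Set ℓ) (A : ℕ) {B : ℕ} {f : Fin A → X} {g : Fin B → X} where

  select-unique : {y : Fin (A ℕ.+ B) → X} → (∀ i → f i ≈ y (i ↑ˡ B)) → (∀ i → g i ≈ y (A ↑ʳ i)) →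
                  ∀ j → select A f g j ≈ y j
  select-unique {y} h k j with splitAt A j in eq
  ... | inj₁ i = ≡.subst (λ t → f i ≈ y t) (Fin.splitAt⁻¹-↑ˡ eq) (h i)
  ... | inj₂ i = ≡.subst (λ t → g i ≈ y t) (Fin.splitAt⁻¹-↑ʳ eq) (k i)

select-↑ˡ : ∀ {a} {X : Set a} A {B} (f : Fin A → X) (g : Fin B → X) i → select A f g (i ↑ˡ B) ≡ f i
select-↑ˡ A {B} f g i = ≡.cong [ f , g ]′ (Fin.splitAt-↑ˡ A i B)

select-↑ʳ : ∀ {a} {X : Set a} A {B} (f : Fin A → X) (g : Fin B → X) i → select A f g (A ↑ʳ i) ≡ g i
select-↑ʳ A {B} f g i = ≡.cong [ f , g ]′ (Fin.splitAt-↑ʳ A B i)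

𝕃-product : ∀ A B → IsProduct 𝕃-category (p₁ A B) (p₂ A B)
𝕃-product A B {X} f g = select A f g
  , ( (λ k i → ℝ-Ring.trans (sum-δˡ (k ↑ˡ B) λ j → weight (select A f g j) i)
                 (ℝ-Ring.reflexive (≡.cong (λ r → weight r i) (select-↑ˡ A f g k))))
    , (λ k i → ℝ-Ring.trans (sum-δˡ (A ↑ʳ k) λ j → weight (select A f g j) i)
                 (ℝ-Ring.reflexive (≡.cong (λ r → weight r i) (select-↑ʳ A f g k)))))
  , λ {y} (h , k) → select-unique (λ r s → ∀ i → weight r i ≈ᵣ weight s i) A {f = f} {g} {y}
      (λ a i → ℝ-Ring.trans (ℝ-Ring.sym (h a i)) (sum-δˡ (a ↑ˡ B) λ j → weight (y j) i))
      (λ b i → ℝ-Ring.trans (ℝ-Ring.sym (k b i)) (sum-δˡ (A ↑ʳ b) λ j → weight (y j) i))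

𝕃-terminal : IsTerminal 𝕃-category 0
𝕃-terminal X = (λ ()) , λ g ()

module _ {o h e o′ h′ e′} {𝓒 : Category o h e} {𝓓 : Category o′ h′ e′} (F : Functor 𝓒 𝓓) where
  private
    module 𝓒 = Category 𝓒
    module 𝓓 = Category 𝓓
  open Functor F

  private
    F-triangle : ∀ {A B C X} {f : B 𝓒.⇒ C} {g : A 𝓒.⇒ B} {h : A 𝓒.⇒ C} (k : X 𝓓.⇒ F₀ A) →
                 f 𝓒.∘ g 𝓒.≈ h → F₁ f 𝓓.∘ F₁ g 𝓓.∘ k 𝓓.≈ F₁ h 𝓓.∘ k
    F-triangle k e = 𝓓.Equiv.trans (𝓓.Equiv.sym 𝓓.assoc)
      (𝓓.∘-cong (𝓓.Equiv.trans (𝓓.Equiv.sym F-∘) (F-cong e)) 𝓓.Equiv.refl)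

  -- Two product cones over A and B are isomorphic through φ and ψ, and F preserves this comparison.
  -- Preservation therefore has to be checked only for the canonical cone on A + B.
  preserves-all-products :
    ∀ {A B Q P} {p : Q 𝓒.⇒ A} {q : Q 𝓒.⇒ B} {π₁ : P 𝓒.⇒ A} {π₂ : P 𝓒.⇒ B} →
    IsProduct 𝓒 p q → IsProduct 𝓓 (F₁ p) (F₁ q) → IsProduct 𝓒 π₁ π₂ → IsProduct 𝓓 (F₁ π₁) (F₁ π₂)
  preserves-all-products {p = p} {q} {π₁} {π₂} Q-product FQ-product P-product f g =
    let φ , (φ₁ , φ₂) , _ = Q-product π₁ π₂
        ψ , (ψ₁ , ψ₂) , _ = P-product p q
        _ , _ , unique    = P-product π₁ π₂
        k , (k₁ , k₂) , k-unique = FQ-product f g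
        module E = 𝓒.Equiv
        module E′ = 𝓓.Equiv
        ψφ = E.trans
          (E.sym (unique {ψ 𝓒.∘ φ}
            ( E.trans (E.sym 𝓒.assoc) (E.trans (𝓒.∘-cong ψ₁ E.refl) φ₁)
            , E.trans (E.sym 𝓒.assoc) (E.trans (𝓒.∘-cong ψ₂ E.refl) φ₂))))
          (unique (𝓒.identityʳ , 𝓒.identityʳ))
    in F₁ ψ 𝓓.∘ k
     , (E′.trans (F-triangle k ψ₁) k₁ , E′.trans (F-triangle k ψ₂) k₂)
     , λ {y} (y₁ , y₂) → E′.trans
         (𝓓.∘-cong E′.refl (k-unique (E′.trans (F-triangle y φ₁) y₁ , E′.trans (F-triangle y φ₂) y₂)))
         (E′.trans (F-triangle y ψφ) (E′.trans (𝓓.∘-cong F-id E′.refl) 𝓓.identityˡ))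

module _ {n m ι} {I : Set ι} {f : I → n 𝕃.⇒ m} where

  𝕃-directed-at : Directed (𝕃.Hom n m) f → ∀ k → Directed (subdistributions n) (λ i → f i k)
  𝕃-directed-at D k .inhabitant = inhabitant D
  𝕃-directed-at D k .bound i j = let l , p , q = bound D i j in l , p k , q k

  -- Not an instance of lub-at, since subdistributions n is not constructively directed complete.
  𝕃-lub-at : ∀ {g} → IsLub (𝕃.Hom n m) f g → ∀ k → IsLub (subdistributions n) (λ i → f i k) (g k)
  𝕃-lub-at l k .upper i = upper l i k
  𝕃-lub-at {g} l k .least u h a = Reals.≤-trans (least l u′ f≤u′ k a) (u′k≤u a)
    where
    -- The tuple `g` with its k-th row replaced by `u`, which bounds the whole family.
    u′ : n 𝕃.⇒ m
    u′ j with j Fin.≟ k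
    ... | yes _ = u
    ... | no  _ = g j

    f≤u′ : ∀ i j a → weight (f i j) a ≤ᵣ weight (u′ j) a
    f≤u′ i j with j Fin.≟ k
    ... | yes ≡.refl = h i
    ... | no  _      = upper l i j

    u′k≤u : ∀ a → weight (u′ k) a ≤ᵣ weight u a
    u′k≤u a with k Fin.≟ k
    ... | yes _  = Reals.≤-refl
    ... | no k≢k = contradiction ≡.refl k≢k

-- Powers of Kegelspitzen

module _ {ℓ : Level} where
  open StrictScottMap
  private
    module Dcpo⊥! = PosetCategory (Dcpo⊥! ℓ)
    module P (X : PointedDcpo ℓ) = PointedDcpo X

  strict-from-⊥ : ∀ {X Y : PointedDcpo ℓ} {f} → ScottContinuous (P.poset X) (P.poset Y) ℓ f →
                  P._≤_ Y (f (P.⊥ X)) (P.⊥ Y) → Strict (P.poset X) (P.poset Y) f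
  strict-from-⊥ {X} {Y} F h l y = P.trans Y (mono F (l (P.⊥ X))) (P.trans Y h (P.⊥-least Y y))

  0ˢ : ∀ {X Y} → StrictScottMap ℓ X Y
  0ˢ {X} {Y} = record { fun = λ _ → P.⊥ Y ; strict = λ _ → P.⊥-least Y ; scott = scott-const (P.⊥ Y) }

  module _ {X Y : PointedDcpo ℓ} {I : Set ℓ} {f : I → StrictScottMap ℓ X Y} (D : Directed (Dcpo⊥!.Hom X Y) f) where
    private
      module X = PointedDcpo X
      module Y = PointedDcpo Y

      D-at : ∀ x → Directed Y.poset (λ i → fun (f i) x)
      D-at x .inhabitant = inhabitant D
      D-at x .bound i j = let k , p , q = bound D i j in k , p x , q x

      sup : ∀ x → ∃ (IsLub Y.poset (λ i → fun (f i) x))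
      sup x = Y.directedComplete _ (D-at x)

      sup-mono : ∀ {x y} → x X.≤ y → proj₁ (sup x) Y.≤ proj₁ (sup y)
      sup-mono {x} {y} h = lub-mono Y.poset (λ i → mono (scott (f i)) h) (proj₂ (sup x)) (proj₂ (sup y))

    ⨆ˢ : StrictScottMap ℓ X Y
    ⨆ˢ = record
      { fun    = λ x → proj₁ (sup x)
      ; strict = λ {x} h y → least (proj₂ (sup x)) y λ i → strict (f i) h y
      ; scott  = record
        { mono   = sup-mono
        ; pres-⨆ = λ {_} {x} {s} E l → record
          { upper = λ j → sup-mono (upper l j)
          ; least = λ u h → least (proj₂ (sup s)) u λ i → least (pres-⨆ (scott (f i)) E l) u λ j →
              Y.trans (upper (proj₂ (sup (x j))) i) (h j)
          }
        }
      }

    -- A supremum in the hom-poset is least only among strict Scott-continuous maps; the pointwise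
    -- supremum `⨆ˢ` is such a map, so the two agree.
    Dcpo⊥!-lub-at : ∀ {g} → IsLub (Dcpo⊥!.Hom X Y) f g → ∀ x → IsLub Y.poset (λ i → fun (f i) x) (fun g x)
    Dcpo⊥!-lub-at l x .upper i   = upper l i x
    Dcpo⊥!-lub-at l x .least u h = Y.trans (least l ⨆ˢ (λ i y → upper (proj₂ (sup y)) i) x) (least (proj₂ (sup x)) u h)

  eval-scott : ∀ {X Y} (x : P.Carrier X) → ScottContinuous (Dcpo⊥!.Hom X Y) (P.poset Y) ℓ (λ f → fun f x)
  eval-scott x .mono h = h x
  eval-scott {X} {Y} x .pres-⨆ {x = f} D l = Dcpo⊥!-lub-at {f = f} D l x

  power : PointedDcpo ℓ → ℕ → PointedDcpo ℓ
  power X n = record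
    { dcpo = record
      { poset            = pointwise (Fin n) (P.poset X)
      ; directedComplete = λ x D → let s = λ a → P.directedComplete X _ (directed-at (P.poset X) D a) in
          (λ a → proj₁ (s a)) , lub-pointwise (P.poset X) (λ a → proj₂ (s a))
      }
    ; ⊥       = λ _ → P.⊥ X
    ; ⊥-least = λ x i → P.⊥-least X (x i)
    }

  tuple : ∀ {X Y n} → (Fin n → StrictScottMap ℓ X Y) → StrictScottMap ℓ X (power Y n)
  tuple f = record
    { fun    = λ x i → fun (f i) x
    ; strict = λ h y i → strict (f i) h (y i)
    ; scott  = scott-pointwise λ i → scott (f i)
    }

  component : ∀ {X n} → Fin n → StrictScottMap ℓ (power X n) X
  component {X} {n} i = record
    { fun    = λ x → x i
    ; strict = λ h y → h (λ _ → y) i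
    ; scott  = record { mono = λ h → h i ; pres-⨆ = λ D l → lub-at (P.poset X) (P.directedComplete X) D l i }
    }

  pointed : Kegelspitze ℓ → PointedDcpo ℓ
  pointed K = record { dcpo = dcpo ; ⊥ = ⊥ ; ⊥-least = ⊥-least }
    where open Kegelspitze K

  module Powers (K : Kegelspitze ℓ) where
    open Kegelspitze K
    open Subconvex pointedConvexDcpo
    open Weights K

    powerMap : ∀ {n m} → n 𝕃.⇒ m → StrictScottMap ℓ (power (pointed K) n) (power (pointed K) m)
    powerMap f = tuple {Y = pointed K} λ k → record
      { fun    = subcombine (f k)
      ; strict = strict-from-⊥ {X = power (pointed K) _} {pointed K} (subcombine-scottʳ (f k)) (reflexive (subcombine-⊥ (f k)))
      ; scott  = subcombine-scottʳ (f k)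
      }

    powerMap-0 : ∀ {n m} {f : n 𝕃.⇒ m} → IsLeast (𝕃.Hom n m) f → ∀ x k → subcombine (f k) x ≈ ⊥
    powerMap-0 {f = f} h x k = antisym
      (trans (mono (subcombine-scottˡ x) {f k} {0ᵈ} (h 0ᵃ k)) (reflexive (subcombine-0 x)))
      (⊥-least _)

    powers-functor : Functor 𝕃-category Dcpo⊥!.category
    powers-functor .Functor.F₀ = power (pointed K)
    powers-functor .Functor.F₁ = powerMap
    powers-functor .Functor.F-cong {f = f} {g} h x k = subcombine-congˡ (f k) (g k) (h k)
    powers-functor .Functor.F-id x k = Eq.trans
      (subcombine-congˡ (𝕃.id k) (δᵈ k) λ _ → ℝ-Ring.refl) (subcombine-δ k x)
    powers-functor .Functor.F-∘ {f = f} {g} x k = Eq.trans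
      (subcombine-congˡ ((f 𝕃.∘ g) k) (f k ⊛ᵈ g) λ _ → ℝ-Ring.refl) (Eq.sym (subcombine-⊛ (f k) g x))

    powers-product : ∀ A B → IsProduct Dcpo⊥!.category (powerMap (p₁ A B)) (powerMap (p₂ A B))
    powers-product A B {X} f g = h
      , ( (λ x i → Eq.trans (subcombine-δ (i ↑ˡ B) _)
             (Eq.reflexive (≡.cong (λ (k : StrictScottMap ℓ X (pointed K)) → fun k x) (select-↑ˡ A f′ g′ i))))
        , (λ x i → Eq.trans (subcombine-δ (A ↑ʳ i) _)
             (Eq.reflexive (≡.cong (λ (k : StrictScottMap ℓ X (pointed K)) → fun k x) (select-↑ʳ A f′ g′ i)))))
      , λ {y} (u , v) x j → select-unique {X = StrictScottMap ℓ X (pointed K)} (λ a b → fun a x ≈ fun b x) A {f = f′} {g′}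
          {λ j → component {X = pointed K} j Dcpo⊥!.∘ y}
          (λ i → Eq.trans (Eq.sym (u x i)) (subcombine-δ (i ↑ˡ B) _))
          (λ i → Eq.trans (Eq.sym (v x i)) (subcombine-δ (A ↑ʳ i) _)) j
      where
      f′ : Fin A → StrictScottMap ℓ X (pointed K)
      f′ i = component {X = pointed K} i Dcpo⊥!.∘ f

      g′ : Fin B → StrictScottMap ℓ X (pointed K)
      g′ i = component {X = pointed K} i Dcpo⊥!.∘ g

      h : StrictScottMap ℓ X (power (pointed K) (A ℕ.+ B))
      h = tuple {Y = pointed K} (select A f′ g′)

    powers-strict : ∀ {n m} {f : n 𝕃.⇒ m} → IsLeast (𝕃.Hom n m) f →
                    IsLeast (Dcpo⊥!.Hom (power (pointed K) n) (power (pointed K) m)) (powerMap f)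
    powers-strict {f = f} h g x k = trans (reflexive (powerMap-0 {f = f} h x k)) (⊥-least _)

    powers-scott : ∀ {n m} → ScottContinuous (𝕃.Hom n m) (Dcpo⊥!.Hom (power (pointed K) n) (power (pointed K) m)) ℓ powerMap
    powers-scott .mono {f} {g} h x k = mono (subcombine-scottˡ x) {f k} {g k} (h k)
    powers-scott .pres-⨆ {I} {f} {g} D l .upper i x k = mono (subcombine-scottˡ x) {f i k} {g k} (upper l i k)
    powers-scott {n} .pres-⨆ {I} {f} {g} D l .least u h x k = least
      (pres-⨆ (subcombine-scottˡ x) {x = λ i → f i k} {g k}
        (𝕃-directed-at {f = f} D k) (𝕃-lub-at {f = f} {g} l k))
      (fun u x k) λ i → h i x k

    -- On a terminal T the identity matrix equals the zero matrix. Letting both act on a tuple shows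
    -- that each of its components is ⊥, without first proving that T is 0.
    powers-terminal : ∀ {T} → IsTerminal 𝕃-category T → IsTerminal Dcpo⊥!.category (power (pointed K) T)
    powers-terminal {T} terminal X = 0ˢ , λ g x k →
      Eq.sym (Eq.trans (Eq.sym (subcombine-δ k (fun g x)))
        (Eq.trans (subcombine-congˡ (δᵈ k) 0ᵈ (id≈0 k)) (subcombine-0 (fun g x))))
      where
      id≈0 : ∀ i j → weight (δᵈ {T} i) j ≈ᵣ 0ᵣ
      id≈0 i j = ℝ-Ring.trans (ℝ-Ring.sym (proj₂ (terminal T) 𝕃.id i j)) (proj₂ (terminal T) (0ᵃ {T} {T}) i j)

    powers : ProductFunctor ℓ 𝕃≤1 (Dcpo⊥! ℓ)
    powers .ProductFunctor.functor                = powers-functor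
    powers .ProductFunctor.strict {x = f}         = powers-strict {f = f}
    powers .ProductFunctor.scott                  = powers-scott
    powers .ProductFunctor.pres-terminal          = powers-terminal
    powers .ProductFunctor.pres-product {A} {B}   =
      preserves-all-products powers-functor (𝕃-product A B) (powers-product A B)

  -- The Kegelspitze of a product-preserving functor

  module Model (Φ : ProductFunctor ℓ 𝕃≤1 (Dcpo⊥! ℓ)) where
    open ProductFunctor Φ
    private
      module X n = PointedDcpo (F₀ n)

    X¹ : PointedDcpo ℓ
    X¹ = F₀ 1

    open PointedDcpo X¹

    F-triangle : ∀ {n m k} {f : m 𝕃.⇒ k} {g : n 𝕃.⇒ m} (h : n 𝕃.⇒ k) →
                 (∀ i j → weight ((f 𝕃.∘ g) i) j ≈ᵣ weight (h i) j) →
                 ∀ a → X._≈_ k (fun (F₁ f) (fun (F₁ g) a)) (fun (F₁ h) a)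
    F-triangle {n} {m} {k} {f} {g} h e a = X.Eq.trans k (X.Eq.sym k (F-∘ {f = f} {g} a)) (F-cong {f = f 𝕃.∘ g} {h} e a)

    F-0 : ∀ {n m} (f : n 𝕃.⇒ m) → (∀ i j → weight (f i) j ≈ᵣ 0ᵣ) → ∀ a → X._≈_ m (fun (F₁ f) a) (X.⊥ m)
    F-0 {n} {m} f e a = X.antisym m
      (X.trans m (X.reflexive m (F-cong {f = f} {0ᵃ} e a)) (ProductFunctor.strict Φ {x = 0ᵃ} (0ᵃ-least {n} {m}) (0ˢ {X = F₀ n} {F₀ m}) a))
      (X.⊥-least m _)

    unpack : ∀ n → StrictScottMap ℓ (F₀ n) (power X¹ n)
    unpack n = tuple {X = F₀ n} {X¹} λ i → F₁ (proj i)

    head-map : ∀ n → StrictScottMap ℓ (power X¹ (suc n)) X¹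
    head-map n = component {X = X¹} zero

    tail-map : ∀ n → StrictScottMap ℓ (power X¹ (suc n)) (power X¹ n)
    tail-map n = tuple {X = power X¹ (suc n)} {X¹} λ i → component {X = X¹} (suc i)

    F-product : ∀ n → IsProduct Dcpo⊥!.category (F₁ (p₁ 1 n)) (F₁ (p₂ 1 n))
    F-product n = pres-product (𝕃-product 1 n)

    F-terminal : IsTerminal Dcpo⊥!.category (F₀ 0)
    F-terminal = pres-terminal 𝕃-terminal

    -- The inverse of `unpack`. Since Φ preserves the terminal object and binary products, it is
    -- built by recursion along `suc n` = 1 + n.
    pack : ∀ n → StrictScottMap ℓ (power X¹ n) (F₀ n)
    pack zero    = proj₁ (F-terminal (power X¹ 0))
    pack (suc n) = proj₁ (F-product n {power X¹ (suc n)} (head-map n) (pack n Dcpo⊥!.∘ tail-map n))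

    pack-head : ∀ n x → fun (F₁ (p₁ 1 n)) (fun (pack (suc n)) x) ≈ x zero
    pack-head n = proj₁ (proj₁ (proj₂ (F-product n {power X¹ (suc n)} (head-map n) (pack n Dcpo⊥!.∘ tail-map n))))

    pack-tail : ∀ n x → X._≈_ n (fun (F₁ (p₂ 1 n)) (fun (pack (suc n)) x)) (fun (pack n) (tail x))
    pack-tail n = proj₂ (proj₁ (proj₂ (F-product n {power X¹ (suc n)} (head-map n) (pack n Dcpo⊥!.∘ tail-map n))))

    proj-p₂ : ∀ {n} (i : Fin n) a → fun (F₁ (proj i)) (fun (F₁ (p₂ 1 n)) a) ≈ fun (F₁ (proj (suc i))) a
    proj-p₂ {n} i = F-triangle {f = proj i} {p₂ 1 n} (proj (suc i)) λ _ j → sum-δˡ i λ l → δ (suc l) j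

    pack-proj : ∀ n x i → fun (F₁ (proj i)) (fun (pack n) x) ≈ x i
    pack-proj (suc n) x zero    = Eq.trans
      (F-cong {f = proj zero} {p₁ 1 n} (λ { zero j → ℝ-Ring.refl }) (fun (pack (suc n)) x)) (pack-head n x)
    pack-proj (suc n) x (suc i) = Eq.trans (Eq.sym (proj-p₂ i (fun (pack (suc n)) x)))
      (Eq.trans (ScottContinuous.cong (scott (F₁ (proj i))) (pack-tail n x)) (pack-proj n (tail x) i))

    pack-cong : ∀ n {x y : Fin n → Carrier} → (∀ i → x i ≈ y i) → X._≈_ n (fun (pack n) x) (fun (pack n) y)
    pack-cong n = ScottContinuous.cong (scott (pack n))

    pack-unpack : ∀ n a → X._≈_ n (fun (pack n) (fun (unpack n) a)) a
    pack-unpack zero a = X.Eq.trans 0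
      (X.Eq.sym 0 (proj₂ (F-terminal (F₀ 0)) (pack 0 Dcpo⊥!.∘ unpack 0) a))
      (proj₂ (F-terminal (F₀ 0)) Dcpo⊥!.id a)
    pack-unpack (suc n) a = X.Eq.trans (suc n)
      (X.Eq.sym (suc n) (unique {pack (suc n) Dcpo⊥!.∘ unpack (suc n)}
        ( (λ b → Eq.trans (pack-head n (fun (unpack (suc n)) b))
             (F-cong {f = proj zero} {p₁ 1 n} (λ { zero j → ℝ-Ring.refl }) b))
        , (λ b → X.Eq.trans n (pack-tail n (fun (unpack (suc n)) b))
             (X.Eq.trans n (pack-cong n λ i → Eq.sym (proj-p₂ i b)) (pack-unpack n (fun (F₁ (p₂ 1 n)) b))))) a))
      (unique {Dcpo⊥!.id} ((λ b → Eq.refl) , (λ b → X.Eq.refl n)) a)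
      where
      unique = λ {y} → proj₂ (proj₂ (F-product n {F₀ (suc n)} (F₁ (p₁ 1 n)) (F₁ (p₂ 1 n)))) {y}

    proj-jointly-monic : ∀ n {a b} → (∀ i → fun (F₁ (proj i)) a ≈ fun (F₁ (proj i)) b) → X._≈_ n a b
    proj-jointly-monic n {a} {b} h = X.Eq.trans n (X.Eq.sym n (pack-unpack n a))
      (X.Eq.trans n (pack-cong n h) (pack-unpack n b))

    act : ∀ {n} → 𝓓∞≤1 n → StrictScottMap ℓ (power X¹ n) X¹
    act {n} r = F₁ (arrow r) Dcpo⊥!.∘ pack n

    act-congˡ : ∀ {n} (r s : 𝓓∞≤1 n) → (∀ i → weight r i ≈ᵣ weight s i) → ∀ x → fun (act r) x ≈ fun (act s) x
    act-congˡ {n} r s h x = F-cong {f = arrow r} {arrow s} (λ _ → h) (fun (pack n) x)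

    act-congʳ : ∀ {n} (r : 𝓓∞≤1 n) {x y : Fin n → Carrier} → (∀ i → x i ≈ y i) → fun (act r) x ≈ fun (act r) y
    act-congʳ {n} r h = ScottContinuous.cong (scott (F₁ (arrow r))) (pack-cong n h)

    -- The projections are jointly monic on `F₀ m`, and `proj k ∘ f` is the k-th row of `f`. Under
    -- the identification of `F₀ n` with a power, a matrix thus acts row by row.
    F₁-pack : ∀ {n m} (f : n 𝕃.⇒ m) x → X._≈_ m (fun (pack m) (λ k → fun (act (f k)) x)) (fun (F₁ f) (fun (pack n) x))
    F₁-pack {n} {m} f x = proj-jointly-monic m λ k → Eq.trans
      (pack-proj m (λ k → fun (act (f k)) x) k)
      (Eq.sym (F-triangle {f = proj k} {f} (arrow (f k)) (λ _ j → sum-δˡ k λ l → weight (f l) j) (fun (pack n) x)))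

    act-⊛ : ∀ {n m} (r : 𝓓∞≤1 m) (s : n 𝕃.⇒ m) x → fun (act r) (λ j → fun (act (s j)) x) ≈ fun (act (r ⊛ᵈ s)) x
    act-⊛ {n} r s x = Eq.trans
      (ScottContinuous.cong (scott (F₁ (arrow r))) (F₁-pack s x))
      (F-triangle {f = arrow r} {s} (arrow (r ⊛ᵈ s)) (λ _ j → ℝ-Ring.refl) (fun (pack n) x))

    model-convex : ConvexStructure Eq.setoid
    model-convex = record
      { combine       = λ r → fun (act (simplexᵈ r))
      ; combine-cong  = λ {_} {r} {s} {x} h k → Eq.trans
          (act-congˡ (simplexᵈ r) (simplexᵈ s) h x) (act-congʳ (simplexᵈ s) k)
      ; combine-dirac = λ {n} i x → Eq.trans
          (act-congˡ (simplexᵈ (dirac i)) (δᵈ i) (λ _ → ℝ-Ring.refl) x) (pack-proj n x i)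
      ; combine-⊛     = λ r s x → Eq.trans (act-⊛ (simplexᵈ r) (λ i → simplexᵈ (s i)) x)
          (act-congˡ (simplexᵈ r ⊛ᵈ λ i → simplexᵈ (s i)) (simplexᵈ (r ⊛ˢ s)) (λ _ → ℝ-Ring.refl) x)
      }

    model-pcd : PointedConvexDcpo ℓ
    model-pcd .PointedConvexDcpo.convexDcpo = record
      { dcpo          = PointedDcpo.dcpo X¹
      ; convex        = model-convex
      ; combine-scott = λ r → scott (act (simplexᵈ r))
      }
    model-pcd .PointedConvexDcpo.⊥       = ⊥
    model-pcd .PointedConvexDcpo.⊥-least = ⊥-least

    open Subconvex model-pcd using (subcombine; ·-subcombine)

    -- The matrix `⊥-row` puts a zero row on top of the identity. Strictness of Φ on hom-sets sends
    -- the zero row to ⊥, so its image turns x into `⊥ ∷ x`; multiplying by `extend r` then gives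
    -- back `r`.
    subcombine-act : ∀ {n} (r : 𝓓∞≤1 n) x → subcombine r x ≈ fun (act r) x
    subcombine-act {n} r x = Eq.trans
      (ScottContinuous.cong (scott (F₁ (arrow (simplexᵈ (extend r))))) pack-⊥∷x)
      (F-triangle {f = arrow (simplexᵈ (extend r))} {⊥-row} (arrow r) weights (fun (pack n) x))
      where
      ⊥-row : n 𝕃.⇒ suc n
      ⊥-row zero    = 0ᵈ
      ⊥-row (suc i) = δᵈ i

      weights : ∀ (i : Fin 1) j → weight ((arrow (simplexᵈ (extend r)) 𝕃.∘ ⊥-row) i) j ≈ᵣ weight r j
      weights i j = ℝ-Ring.trans (ℝ-Ring.+-congʳ (ℝ-Ring.zeroʳ _)) (ℝ-Ring.trans (ℝ-Ring.+-identityˡ _) (sum-δʳ j (weight r)))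

      row : ∀ i → fun (F₁ (proj i)) (fun (F₁ ⊥-row) (fun (pack n) x)) ≈ (⊥ ∷ x) i
      row zero    = Eq.trans
        (F-triangle {f = proj zero} {⊥-row} 0ᵃ (λ _ j → sum-δˡ zero λ l → weight (⊥-row l) j) (fun (pack n) x))
        (F-0 (0ᵃ {n} {1}) (λ _ _ → ℝ-Ring.refl) (fun (pack n) x))
      row (suc i) = Eq.trans
        (F-triangle {f = proj (suc i)} {⊥-row} (proj i) (λ _ j → sum-δˡ (suc i) λ l → weight (⊥-row l) j) (fun (pack n) x))
        (pack-proj n x i)

      pack-⊥∷x : X._≈_ (suc n) (fun (pack (suc n)) (⊥ ∷ x)) (fun (F₁ ⊥-row) (fun (pack n) x))
      pack-⊥∷x = proj-jointly-monic (suc n) λ i → Eq.trans (pack-proj (suc n) (⊥ ∷ x) i) (Eq.sym (row i))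

    scalar : UnitInterval → 1 𝕃.⇒ 1
    scalar p = arrow [ p ]ᵈ

    scalar-scott : ScottContinuous unitInterval (𝕃.Hom 1 1) ℓ scalar
    scalar-scott .mono h _ _ = h
    scalar-scott .pres-⨆ D l .upper i _ _ = upper l i
    scalar-scott .pres-⨆ D l .least u h zero zero = least l (headᵈ (u zero)) λ i → h i zero zero

    model : Kegelspitze ℓ
    model .Kegelspitze.pointedConvexDcpo = model-pcd
    -- A scalar acts as the image under Φ of a 1 × 1 matrix, so this is the continuity of Φ on
    -- hom-sets followed by evaluation at a point.
    model .Kegelspitze.·-scottˡ x = scott-resp {P = unitInterval} {poset}
      (λ p → Eq.sym (Eq.trans (·-subcombine p x) (subcombine-act [ p ]ᵈ λ _ → x)))
      (scott-∘ {R = poset} (eval-scott {X = X¹} {X¹} (fun (pack 1) λ _ → x)) (scott-∘ (ProductFunctor.scott Φ) scalar-scott))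
    model .Kegelspitze.·-scottʳ = ·-scottʳ model-pcd

  -- The equivalence

  private
    module KS = Dcpo⊥!-Category (KS ℓ)
    module K (X : Kegelspitze ℓ) = Kegelspitze X
    module PF = ProductFunctor
    module Hom = AffineScottMap
    open NaturalTransformation

    Models : Category _ _ _
    Models = [ ℓ , 𝕃≤1 , Dcpo⊥! ℓ ]ₓ

  functorOf : ProductFunctor ℓ 𝕃≤1 (Dcpo⊥! ℓ) → Functor 𝕃-category Dcpo⊥!.category
  functorOf = PF.functor

  module _ {X Y : Kegelspitze ℓ} (h : AffineScottMap X Y) where
    private
      module X = Kegelspitze X
      module Y = Kegelspitze Y

    -- Strictness takes care of the missing mass, which sits on ⊥.
    affine-subcombine : ∀ {n} (r : 𝓓∞≤1 n) x →
      Hom.fun h (Subconvex.subcombine X.pointedConvexDcpo r x) Y.≈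
      Subconvex.subcombine Y.pointedConvexDcpo r (λ i → Hom.fun h (x i))
    affine-subcombine r x = Y.Eq.trans (Hom.affine h (extend r) (X.⊥ ∷ x))
      (Y.combine-cong (λ _ → ℝ-Ring.refl)
        λ { zero    → Y.antisym (Hom.strict h X.⊥-least Y.⊥) (Y.⊥-least _)
          ; (suc i) → Y.Eq.refl })

    strictMap : StrictScottMap ℓ (pointed X) (pointed Y)
    strictMap = record { fun = Hom.fun h ; strict = Hom.strict h ; scott = Hom.scott h }

    powerwise : ∀ n → StrictScottMap ℓ (power (pointed X) n) (power (pointed Y) n)
    powerwise n = tuple {X = power (pointed X) n} {pointed Y} {n} λ i → Dcpo⊥!._∘_ {power (pointed X) n} {pointed X} {pointed Y} strictMap (component {X = pointed X} {n} i)

    powers-natural : ∀ {n m} (f : n 𝕃.⇒ m) x k →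
      fun (powerwise m) (fun (Powers.powerMap X f) x) k Y.≈ fun (Powers.powerMap Y f) (fun (powerwise n) x) k
    powers-natural f x k = affine-subcombine (f k) x

    powers-map : NaturalTransformation (Powers.powers-functor X) (Powers.powers-functor Y)
    powers-map = record { η = powerwise ; natural = λ {n} {m} f x k → powers-natural {n} {m} f x k }

  Powers-functor : Functor KS.category Models
  Powers-functor .Functor.F₀ = Powers.powers
  Powers-functor .Functor.F₁ {X} {Y} = powers-map {X} {Y}
  Powers-functor .Functor.F-cong h n x i = h (x i)
  Powers-functor .Functor.F-id {X} n x i = K.Eq.refl X
  Powers-functor .Functor.F-∘ {C = Z} n x i = K.Eq.refl Z

  module _ {Φ Ψ : ProductFunctor ℓ 𝕃≤1 (Dcpo⊥! ℓ)} (α : NaturalTransformation (functorOf Φ) (functorOf Ψ)) where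
    private
      module Φ where
        open ProductFunctor Φ public
        open Model Φ public
      module Ψ where
        open ProductFunctor Ψ public
        open Model Ψ public
      module Φ¹ = PointedDcpo Φ.X¹
      module Ψ¹ = PointedDcpo Ψ.X¹

    natural-at : ∀ {n m} (f : n 𝕃.⇒ m) a →
      PointedDcpo._≈_ (Ψ.F₀ m) (fun (η α m) (fun (Φ.F₁ f) a)) (fun (Ψ.F₁ f) (fun (η α n) a))
    natural-at f a = natural α f a

    η-cong : ∀ n {a b} → PointedDcpo._≈_ (Φ.F₀ n) a b → PointedDcpo._≈_ (Ψ.F₀ n) (fun (η α n) a) (fun (η α n) b)
    η-cong n = ScottContinuous.cong (scott (η α n))

    -- The projections are images of morphisms of `𝕃≤1`, so α commutes with them; hence all its
    -- components are determined by the one at 1.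
    pack-natural : ∀ n x → PointedDcpo._≈_ (Ψ.F₀ n) (fun (Ψ.pack n) λ i → fun (η α 1) (x i)) (fun (η α n) (fun (Φ.pack n) x))
    pack-natural n x = Ψ.proj-jointly-monic n λ i → Ψ¹.Eq.trans
      (Ψ.pack-proj n (λ i → fun (η α 1) (x i)) i)
      (Ψ¹.Eq.trans (η-cong 1 (Φ¹.Eq.sym (Φ.pack-proj n x i))) (natural-at (proj i) (fun (Φ.pack n) x)))

    model-map : AffineScottMap Φ.model Ψ.model
    model-map = record
      { fun    = fun (η α 1)
      ; affine = λ {n} r x → Ψ¹.Eq.trans (natural α (arrow (simplexᵈ r)) (fun (Φ.pack n) x))
          (ScottContinuous.cong (scott (Ψ.F₁ (arrow (simplexᵈ r)))) (PointedDcpo.Eq.sym (Ψ.F₀ n) (pack-natural n x)))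
      ; strict = strict (η α 1)
      ; scott  = scott (η α 1)
      }

  Model-functor : Functor Models KS.category
  Model-functor .Functor.F₀ = Model.model
  Model-functor .Functor.F₁ {Φ} {Ψ} = model-map {Φ} {Ψ}
  Model-functor .Functor.F-cong h = h 1
  Model-functor .Functor.F-id {Φ} x = PointedDcpo.Eq.refl (PF.F₀ Φ 1)
  Model-functor .Functor.F-∘ {C = Ψ} x = PointedDcpo.Eq.refl (PF.F₀ Ψ 1)

  GF : Functor KS.category KS.category
  GF = Model-functor ∘F Powers-functor

  FG : Functor Models Models
  FG = Powers-functor ∘F Model-functor

  module _ (X : Kegelspitze ℓ) where
    open Kegelspitze X
    open Subconvex pointedConvexDcpo
    open Model (Powers.powers X) using (act; pack; pack-proj)

    -- The model of the powers of X has carrier Fin 1 → X, and its `pack` is the one induced by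
    -- product preservation. It is identified with the evident regrouping through its projections.
    act-powers : ∀ {n} (r : Simplex n) x k → fun (act (simplexᵈ r)) x k ≈ combine r (λ i → x i zero)
    act-powers {n} r x k = Eq.trans (subcombine-simplex r (fun (pack n) x))
      (combine-cong (λ _ → ℝ-Ring.refl) λ i →
        Eq.trans (Eq.sym (subcombine-δ i (fun (pack n) x))) (pack-proj n x i zero))

    to-model : AffineScottMap X (Functor.F₀ GF X)
    to-model = record
      { fun    = λ x _ → x
      ; affine = λ r x k → Eq.sym (act-powers r (λ i _ → x i) k)
      ; strict = λ h y k → h (y k)
      ; scott  = scott-pointwise λ _ → scott-id
      }

    from-model : AffineScottMap (Functor.F₀ GF X) X
    from-model = record
      { fun    = λ x → x zero
      ; affine = λ r x → act-powers r x zero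
      ; strict = strict (component {X = pointed X} zero)
      ; scott  = scott (component {X = pointed X} zero)
      }

  to-model-natural : NaturalTransformation {𝓒 = KS.category} {KS.category} idF GF
  to-model-natural = record
    { η       = to-model
    ; natural = λ {X} {Y} h x k → K.Eq.refl Y {Hom.fun h x}
    }

  unit-iso : NaturalIsomorphism {𝓒 = KS.category} {KS.category} idF GF
  unit-iso = record
    { to   = to-model-natural
    ; η⁻¹  = from-model
    ; isoˡ = λ X x → K.Eq.refl X {x}
    ; isoʳ = λ { X x zero → K.Eq.refl X {x zero} }
    }

  module _ (Φ : ProductFunctor ℓ 𝕃≤1 (Dcpo⊥! ℓ)) where
    open ProductFunctor Φ
    open Model Φ
    open PointedDcpo X¹

    pack-transformation : Category._⇒_ Models (Functor.F₀ FG Φ) Φ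
    pack-transformation = record
      { η       = pack
      ; natural = λ {n} {m} f x → PointedDcpo.Eq.trans (F₀ m)
          (pack-cong m λ k → subcombine-act (f k) x) (F₁-pack f x)
      }

    unpack-transformation : Category._⇒_ Models Φ (Functor.F₀ FG Φ)
    unpack-transformation = record
      { η       = unpack
      ; natural = λ {n} {m} f a k → Eq.trans
          (F-triangle {f = proj k} {f} (arrow (f k)) (λ _ j → sum-δˡ k λ l → weight (f l) j) a)
          (Eq.sym (Eq.trans (subcombine-act (f k) (fun (unpack n) a))
            (ScottContinuous.cong (scott (F₁ (arrow (f k)))) (pack-unpack n a))))
      }

  counit-iso : NaturalIsomorphism FG idF
  counit-iso = record
    { to   = record
      { η       = pack-transformation
      ; natural = λ {Φ} {Ψ} α n x → pack-natural {Φ} {Ψ} α n x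
      }
    ; η⁻¹  = unpack-transformation
    ; isoˡ = λ Φ n x i → Model.pack-proj Φ n x i
    ; isoʳ = λ Φ n a → Model.pack-unpack Φ n a
    }

  KS≃Models : KS.category ≃ Models
  KS≃Models = record { F = Powers-functor ; G = Model-functor ; unit = unit-iso ; counit = counit-iso }

corollary5p6 : (ℓ : Level) →
    (Dcpo⊥!-Category.category (KS ℓ) ≃ [ ℓ , 𝕃≤1 , Dcpo⊥! ℓ ]ₓ) ×
    AlgebraicallyCompact (Dcpo⊥!-Category.category (KS ℓ)) (LocallyContinuous (KS ℓ))
corollary5p6 ℓ = KS≃Models , λ F cont → fixpoint F cont
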